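{- For non-preemptive machine minimization with agreeable deadlines, there is a semi-online $9$-competitive algorithm.
   Context: Machine minimization with deadlines: each job $j$ of a finite instance has integer release date $r_j$, processing time $p_j$ and deadline $d_j$. A feasible non-preemptive schedule on a given number of identical machines processes each job uninterrupted on a single machine for $p_j$ consecutive time units within $[r_j,d_j]$, each machine processing at most one job at a time. $m$ is the minimum number of machines admitting such a schedule. Semi-online: each job becomes known only at its release date, decisions are made over time, and $m$ is known in advance. An algorithm is $c$-competitive if on every instance it produces a feasible schedule using at most $c\cdot m$ machines. Agreeable deadlines: for any jobs $j,k$ with $r_j<r_k$ we have $d_j\le d_k$. -}

module Defs where

open import Data.Nat using (ℕ; _+_; _*_; _≤_; _<_; _≤?_)
open import Data.Fin as Fin using (Fin; toℕ)
open import Data.List using (List; length; lookup; takeWhile)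
open import Data.Product using (_×_; Σ; proj₁; proj₂; ∃)
open import Data.Sum using (_⊎_)
open import Relation.Binary.PropositionalEquality using (_≡_; _≢_)
open import Relation.Nullary using (¬_)

-- A job: release date r, processing time p, deadline d (integer time, ℕ).
record Job : Set where
  constructor job
  field
    r : ℕ
    p : ℕ
    d : ℕ
open Job public

Instance : Set
Instance = List Job

JobOf : (I : Instance) → Fin (length I) → Job
JobOf I i = lookup I i

Schedule : Instance → Set
Schedule I = Fin (length I) → ℕ × ℕ

machine : ∀ (I : Instance) → Schedule I → Fin (length I) → ℕ
machine I σ i = proj₁ (σ i)

start : ∀ (I : Instance) → Schedule I → Fin (length I) → ℕ
start I σ i = proj₂ (σ i)

FeasibleSchedule : (I : Instance) → ℕ → Schedule I → Set
FeasibleSchedule I k σ =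
  (∀ i → machine I σ i < k)
  × (∀ i → r (JobOf I i) ≤ start I σ i)
  × (∀ i → start I σ i + p (JobOf I i) ≤ d (JobOf I i))
  × (∀ i j → i ≢ j → machine I σ i ≡ machine I σ j →
       (start I σ i + p (JobOf I i) ≤ start I σ j)
       ⊎ (start I σ j + p (JobOf I j) ≤ start I σ i))

Feasible : Instance → ℕ → Set
Feasible I k = Σ (Schedule I) (FeasibleSchedule I k)

IsOpt : Instance → ℕ → Set
IsOpt I m = Feasible I m × (∀ k → Feasible I k → m ≤ k)

Agreeable : Instance → Set
Agreeable I = ∀ i j → r (JobOf I i) < r (JobOf I j) → d (JobOf I i) ≤ d (JobOf I j)

PositiveTimes : Instance → Set
PositiveTimes I = ∀ i → 1 ≤ p (JobOf I i)

-- Instances are presented in order of nondecreasing release date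
-- (ties in arbitrary, adversarial order).
ReleaseSorted : Instance → Set
ReleaseSorted I = ∀ i j → toℕ i ≤ toℕ j → r (JobOf I i) ≤ r (JobOf I j)

-- The jobs known at time t: those released at or before t
-- (a prefix of a release-sorted instance).
Known : ℕ → Instance → Instance
Known t I = takeWhile (λ j → r j ≤? t) I

-- An algorithm: given m (known in advance) and the instance, produce a schedule.
Algorithm : Set
Algorithm = (m : ℕ) → (I : Instance) → Schedule I

SemiOnline : Algorithm → Set
SemiOnline A =
  ∀ m (I I' : Instance) t → ReleaseSorted I → ReleaseSorted I' →
  Known t I ≡ Known t I' →
  ∀ (i : Fin (length I)) (i' : Fin (length I')) → toℕ i ≡ toℕ i' →
  r (JobOf I i) ≤ t → start I (A m I) i ≤ t →
  A m I' i' ≡ A m I i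

Competitive : ℕ → Algorithm → Set
Competitive c A =
  ∀ (I : Instance) (m : ℕ) → ReleaseSorted I → PositiveTimes I → Agreeable I →
  IsOpt I m → FeasibleSchedule I (c * m) (A m I)

{-# OPTIONS --safe #-}
module Submission where

-- Call a job loose if p ≤ (d - r) / 3 and tight otherwise. Loose jobs are list-scheduled in order of
-- release date (ties by deadline) on 4m machines. Tight jobs run centred in their windows on 5m
-- machines, which list scheduling in order of the fixed starting times provides.
--
-- Tight jobs. Suppose a time slot t lies in the centred interval of each of a set of jobs that one
-- machine of the optimum processes. At most one of them is processed there across t. Of three
-- processed one after the other on the same side of t, each is longer than all those between it and
-- t together: its window reaches at least as far beyond t on the other side as its processing is away
-- from t, yet it is shorter than 3p. Agreeable deadlines force the job next to t to be long as well, a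
-- contradiction. So there are at most 2 + 1 + 2 such jobs per machine, and no tight job has to wait.
--
-- Loose jobs. Fix a job j with deadline D and consider the jobs up to j. Claim: at each time t ≤ D the
-- remaining work of the algorithm exceeds that of the optimum by at most m (D - t). Call a slot busy
-- if 4m of these jobs run in it; in other slots all released jobs are started. After a busy slot the
-- claim persists. After an idle slot let r be the least release date of an unfinished job and b the
-- number of busy slots in [r , t). On unfinished jobs the optimum gains only in busy slots, so the excess
-- is at most m b; by the claim at r it is also at most m (D - r) + m (t - r) - 4 m b; and looseness
-- gives t - r ≤ b + (D - r) / 3. These three bounds imply the claim at t. Hence while j waits, at
-- most 2 m (D - r_j) work is left, which 4m machines do within half of its window.

open import Defs
open import Data.Nat
open import Data.Nat.Properties
open import Data.Bool using (if_then_else_; true; false)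
open import Data.Empty using (⊥; ⊥-elim)
open import Data.Fin using (Fin; zero; suc; toℕ)
open import Data.Fin.Properties using (toℕ-injective)
open import Data.List
  using (List; []; _∷_; _++_; map; filter; length; lookup; dropWhile; upTo)
open import Data.List.Extrema ≤-totalOrder
  using (argmin; argmin-all; f[argmin]≤f[xs]; max; xs≤max; argmax-sel)
open import Data.List.Membership.Propositional using (_∈_)
open import Data.List.Membership.Propositional.Properties
  using (∈-filter⁻; ∈-filter⁺; ∈-map⁺; ∈-map⁻; ∈-upTo⁺; ∈-upTo⁻; ∈-++⁺ˡ; ∈-++⁻; ∈-lookup)
open import Data.List.Properties using (filter-++; filter-none; takeWhile++dropWhile; ++-identityʳ)
open import Data.List.Relation.Binary.Permutation.Propositional using (↭-sym; ↭⇒↭ₛ)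
open import Data.List.Relation.Binary.Permutation.Propositional.Properties using (∈-resp-↭)
open import Data.List.Relation.Binary.Permutation.Setoid.Properties using (AllPairs-resp-↭)
open import Data.List.Relation.Unary.AllPairs using (AllPairs; []; _∷_)
import Data.List.Relation.Unary.AllPairs.Properties as AllPairs
open import Data.List.Relation.Unary.All using (All; []; _∷_)
import Data.List.Relation.Unary.All as All
import Data.List.Relation.Unary.All.Properties as All
open import Data.List.Relation.Unary.Any using (here; there; index)
open import Data.List.Relation.Unary.Any.Properties using (lookup-index)
open import Data.List.Relation.Unary.Linked.Properties using (Linked⇒AllPairs)
import Data.List.Sort.InsertionSort.Base as InsertionSort
import Data.List.Sort.InsertionSort.Properties as InsertionSortProperties
open import Data.Nat.ListAction using (sum)
open import Data.Nat.Tactic.RingSolver using (solve-∀)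
open import Data.Product using (Σ; ∃; _×_; _,_; proj₁; proj₂)
open import Data.Product.Relation.Binary.Lex.NonStrict using (×-decTotalOrder)
open import Data.Sum using (_⊎_; inj₁; inj₂)
open import Level using (0ℓ)
open import Relation.Binary using (DecTotalOrder)
import Relation.Binary.Construct.Flip.EqAndOrd as Flip
import Relation.Binary.Construct.On as On
open import Function using (_∘_; id)
open import Relation.Binary.PropositionalEquality
open import Relation.Nullary using (¬_; Dec; does; yes; no; contradiction)
open import Relation.Nullary.Decidable using (_×-dec_; ¬?)
open import Relation.Unary using (Decidable)

private variable
  A : Set

-- Sums and counting over lists

∑ : List A → (A → ℕ) → ℕ
∑ xs f = sum (map f xs)

𝟙 : {X : Set} → Dec X → ℕ
𝟙 d = if does d then 1 else 0

count : {P : A → Set} → Decidable P → List A → ℕ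
count P? xs = ∑ xs (λ x → 𝟙 (P? x))

∑-mono : ∀ (xs : List A) {f g : A → ℕ} → (∀ {x} → x ∈ xs → f x ≤ g x) → ∑ xs f ≤ ∑ xs g
∑-mono []       f≤g = z≤n
∑-mono (x ∷ xs) f≤g = +-mono-≤ (f≤g (here refl)) (∑-mono xs (f≤g ∘ there))

∑-distrib-+ : ∀ (xs : List A) {f g : A → ℕ} → ∑ xs (λ x → f x + g x) ≡ ∑ xs f + ∑ xs g
∑-distrib-+ []                   = refl
∑-distrib-+ (x ∷ xs) {f} {g} rewrite ∑-distrib-+ xs {f} {g} =
  interchange (f x) (g x) (∑ xs f) (∑ xs g)
  where
  interchange : ∀ a b c d → a + b + (c + d) ≡ a + c + (b + d)
  interchange = solve-∀

∑-cong : ∀ (xs : List A) {f g : A → ℕ} → (∀ x → f x ≡ g x) → ∑ xs f ≡ ∑ xs g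
∑-cong []       f≡g = refl
∑-cong (x ∷ xs) f≡g = cong₂ _+_ (f≡g x) (∑-cong xs f≡g)

𝟙-yes : {X : Set} (d : Dec X) → X → 𝟙 d ≡ 1
𝟙-yes (yes _) _ = refl
𝟙-yes (no ¬x) x = contradiction x ¬x

𝟙-no : {X : Set} (d : Dec X) → ¬ X → 𝟙 d ≡ 0
𝟙-no (yes x) ¬x = contradiction x ¬x
𝟙-no (no _)  _  = refl

𝟙-mono : {X Y : Set} (c : Dec X) (d : Dec Y) → (X → Y) → 𝟙 c ≤ 𝟙 d
𝟙-mono (no _)  d f = z≤n
𝟙-mono (yes x) d f = ≤-reflexive (sym (𝟙-yes d (f x)))

count-mono : ∀ {P Q : A → Set} (P? : Decidable P) (Q? : Decidable Q) xs →
  (∀ {x} → x ∈ xs → P x → Q x) → count P? xs ≤ count Q? xs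
count-mono P? Q? xs P⇒Q = ∑-mono xs (λ {x} x∈ → 𝟙-mono (P? x) (Q? x) (P⇒Q x∈))

count-split : ∀ {P Q : A → Set} (P? : Decidable P) (Q? : Decidable Q) xs →
  count P? xs ≡ count (λ x → P? x ×-dec Q? x) xs + count (λ x → P? x ×-dec ¬? (Q? x)) xs
count-split P? Q? xs = trans (∑-cong xs (λ x → split (P? x) (Q? x))) (∑-distrib-+ xs)
  where
  split : {X Y : Set} (c : Dec X) (d : Dec Y) → 𝟙 c ≡ 𝟙 (c ×-dec d) + 𝟙 (c ×-dec ¬? d)
  split (yes _) (yes _) = refl
  split (yes _) (no _)  = refl
  split (no _)  _       = refl

count-none : ∀ {P : A → Set} (P? : Decidable P) xs → (∀ {x} → x ∈ xs → ¬ P x) → count P? xs ≡ 0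
count-none P? []       none = refl
count-none P? (x ∷ xs) none =
  cong₂ _+_ (𝟙-no (P? x) (none (here refl))) (count-none P? xs (none ∘ there))

count-some : ∀ {P : A → Set} (P? : Decidable P) {xs x} → x ∈ xs → P x → 1 ≤ count P? xs
count-some P? {y ∷ xs} (here refl) px rewrite 𝟙-yes (P? y) px = s≤s z≤n
count-some P? {y ∷ xs} (there x∈)  px = ≤-trans (count-some P? x∈ px) (m≤n+m _ (𝟙 (P? y)))

count≡length-filter : ∀ {P : A → Set} (P? : Decidable P) xs → count P? xs ≡ length (filter P? xs)
count≡length-filter P? []       = refl
count≡length-filter P? (x ∷ xs) with does (P? x)
... | true  = cong suc (count≡length-filter P? xs)
... | false = count≡length-filter P? xs

count-≤-fibres : ∀ {P : A → Set} (f : A → ℕ) (P? : Decidable P) xs c m →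
  (∀ {x} → x ∈ xs → P x → f x < m) →
  (∀ μ → μ < m → count (λ x → P? x ×-dec (f x ≟ μ)) xs ≤ c) →
  count P? xs ≤ m * c
count-≤-fibres f P? xs c zero    f< fib = ≤-reflexive (count-none P? xs (λ x∈ px → n≮0 (f< x∈ px)))
count-≤-fibres f P? xs c (suc m) f< fib = begin
  count P? xs
    ≡⟨ count-split P? (λ x → f x ≟ m) xs ⟩
  count (λ x → P? x ×-dec (f x ≟ m)) xs + count P≢? xs
    ≤⟨ +-mono-≤ (fib m ≤-refl) (count-≤-fibres f P≢? xs c m f<′ fib′) ⟩
  c + m * c ∎
  where
  open ≤-Reasoning
  P≢? = λ x → P? x ×-dec ¬? (f x ≟ m)
  f<′ : ∀ {x} → x ∈ xs → _ → f x < m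
  f<′ x∈ (px , fx≢m) = ≤∧≢⇒< (≤-pred (f< x∈ px)) fx≢m
  fib′ : ∀ μ → μ < m → count (λ x → P≢? x ×-dec (f x ≟ μ)) xs ≤ c
  fib′ μ μ<m = ≤-trans
    (count-mono (λ x → P≢? x ×-dec (f x ≟ μ)) (λ x → P? x ×-dec (f x ≟ μ)) xs
      (λ { _ ((px , _) , eq) → px , eq }))
    (fib μ (m<n⇒m<1+n μ<m))

count-≥-fibres : ∀ {P : A → Set} (f : A → ℕ) (P? : Decidable P) xs k →
  (∀ μ → μ < k → ∃ λ x → x ∈ xs × P x × f x ≡ μ) → k ≤ count P? xs
count-≥-fibres f P? xs zero    hit = z≤n
count-≥-fibres f P? xs (suc k) hit = begin
  1 + k
    ≤⟨ +-mono-≤ (let (x , x∈ , px , eq) = hit k ≤-refl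
                 in count-some (λ x → P? x ×-dec (f x ≟ k)) x∈ (px , eq))
                (count-≥-fibres f P≢? xs k hit′) ⟩
  count (λ x → P? x ×-dec (f x ≟ k)) xs + count P≢? xs
    ≡⟨ count-split P? (λ x → f x ≟ k) xs ⟨
  count P? xs ∎
  where
  open ≤-Reasoning
  P≢? = λ x → P? x ×-dec ¬? (f x ≟ k)
  hit′ : ∀ μ → μ < k → ∃ λ x → x ∈ xs × (_ × _) × f x ≡ μ
  hit′ μ μ<k with hit μ (m<n⇒m<1+n μ<k)
  ... | x , x∈ , px , eq = x , x∈ , (px , λ fx≡k → <⇒≢ μ<k (trans (sym eq) fx≡k)) , eq

count-≤1 : ∀ {P : A → Set} (P? : Decidable P) {xs} {D : A → A → Set} → AllPairs D xs →
  (∀ {x y} → x ∈ xs → y ∈ xs → P x → P y → ¬ D x y) → count P? xs ≤ 1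
count-≤1 P? {xs} distinct clash rewrite count≡length-filter P? xs =
  go (filter P? xs) (AllPairs.filter⁺ P? distinct) (∈-filter⁻ P? {xs = xs})
  where
  go : ∀ ys → AllPairs _ ys → (∀ {y} → y ∈ ys → y ∈ xs × _) → length ys ≤ 1
  go []           _                mem = z≤n
  go (x ∷ [])     _                mem = ≤-refl
  go (x ∷ y ∷ ys) ((xy ∷ _) ∷ _)   mem =
    let (x∈ , px) = mem (here refl); (y∈ , py) = mem (there (here refl))
    in contradiction xy (clash x∈ y∈ px py)

count-≤2 : ∀ {P : A → Set} (P? : Decidable P) {xs} {D : A → A → Set} → AllPairs D xs →
  (∀ {x y z} → x ∈ xs → y ∈ xs → z ∈ xs → P x → P y → P z → D x y → D x z → D y z → ⊥) →
  count P? xs ≤ 2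
count-≤2 P? {xs} distinct clash rewrite count≡length-filter P? xs =
  go (filter P? xs) (AllPairs.filter⁺ P? distinct) (∈-filter⁻ P? {xs = xs})
  where
  go : ∀ ys → AllPairs _ ys → (∀ {y} → y ∈ ys → y ∈ xs × _) → length ys ≤ 2
  go []               _ mem = z≤n
  go (x ∷ [])         _ mem = s≤s z≤n
  go (x ∷ y ∷ [])     _ mem = ≤-refl
  go (x ∷ y ∷ z ∷ ys) ((xy ∷ xz ∷ _) ∷ (yz ∷ _) ∷ _) mem =
    let (x∈ , px) = mem (here refl)
        (y∈ , py) = mem (there (here refl))
        (z∈ , pz) = mem (there (there (here refl)))
    in ⊥-elim (clash x∈ y∈ z∈ px py pz xy xz yz)

minimal : ∀ {P : A → Set} (f : A → ℕ) (P? : Decidable P) xs →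
  (∀ {x} → x ∈ xs → ¬ P x) ⊎
  (∃ λ x → x ∈ xs × P x × (∀ {y} → y ∈ xs → P y → f x ≤ f y))
minimal f P? []       = inj₁ (λ ())
minimal f P? (x ∷ xs) with P? x | minimal f P? xs
... | no ¬px | inj₁ none = inj₁ λ { (here refl) → ¬px ; (there y∈) → none y∈ }
... | no ¬px | inj₂ (z , z∈ , pz , min) =
  inj₂ (z , there z∈ , pz , λ { (here refl) py → contradiction py ¬px ; (there y∈) py → min y∈ py })
... | yes px | inj₁ none =
  inj₂ (x , here refl , px , λ { (here refl) _ → ≤-refl ; (there y∈) py → contradiction py (none y∈) })
... | yes px | inj₂ (z , z∈ , pz , min) with ≤-total (f x) (f z)
...   | inj₁ fx≤fz =
  inj₂ (x , here refl , px , λ { (here refl) _ → ≤-refl ; (there y∈) py → ≤-trans fx≤fz (min y∈ py) })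
...   | inj₂ fz≤fx =
  inj₂ (z , there z∈ , pz , λ { (here refl) _ → fz≤fx ; (there y∈) py → min y∈ py })

-- The linear inequalities below arise by adding up their hypotheses; the ring solver exposes the
-- common summand `c` on both sides.
<-by-difference : ∀ c {a b x y} → x < y → x ≡ c + a → y ≡ c + b → a < b
<-by-difference c x<y refl refl = +-cancelˡ-< c _ _ x<y

-- Three tight jobs in succession

-- Release r, length p, deadline d; late jobs are processed from u ≥ τ on, early ones until c ≤ t.
-- Job 1 is the one next to τ or t. Under agreeable deadlines r₁ ≤ r₃ or d₃ ≤ d₁, and each case
-- contradicts p₁ < p₂ and p₁ + p₂ < p₃, which the length lemmas give.

-- The job starts at least `q` after `τ` and, by `u + r ≤ 2 * τ`, is released at least `q` before
-- it. So its window has length at least `2 * q + p`, while tightness keeps it below `3 * p`.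
late-length : ∀ {τ q u r p d} → τ + q ≤ u → u + r ≤ 2 * τ → u + p ≤ d → d < 3 * p + r → q < p
late-length {τ} {q} {u} {r} {p} {d} h₁ h₂ h₃ h₄ =
  *-cancelˡ-< 2 q p (<-by-difference (2 * τ + 2 * u + r + p + d)
    (+-mono-≤-< h₁ (+-mono-≤-< h₁ (+-mono-≤-< h₂ (+-mono-≤-< h₃ h₄))))
    (lhs τ q u r p d) (rhs τ u r p d))
  where
  lhs : ∀ τ q u r p d → τ + q + (τ + q + (u + r + (u + p + d))) ≡ 2 * τ + 2 * u + r + p + d + 2 * q
  lhs = solve-∀
  rhs : ∀ τ u r p d → u + (u + (2 * τ + (d + (3 * p + r)))) ≡ 2 * τ + 2 * u + r + p + d + 2 * p
  rhs = solve-∀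

-- Job 1 is released no later than job 3, hence at least `p₁ + p₂` before `τ`, and is due at least
-- `p₁` after `τ`. This window of length at least `2 * p₁ + p₂` is shorter than `3 * p₁`.
late-first-longer : ∀ {τ u₁ r₁ p₁ d₁ p₂ u₃ r₃} → τ ≤ u₁ → u₁ + p₁ ≤ d₁ → d₁ < 3 * p₁ + r₁ →
  τ + (p₁ + p₂) ≤ u₃ → u₃ + r₃ ≤ 2 * τ → r₁ ≤ r₃ → p₂ < p₁
late-first-longer {τ} {u₁} {r₁} {p₁} {d₁} {p₂} {u₃} {r₃} h₁ h₂ h₃ h₄ h₅ h₆ =
  <-by-difference (2 * τ + u₁ + d₁ + u₃ + r₃ + r₁ + 2 * p₁)
    (+-mono-≤-< h₁ (+-mono-≤-< h₂ (+-mono-<-≤ h₃ (+-mono-≤ h₄ (+-mono-≤ h₅ h₆)))))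
    (lhs τ u₁ r₁ p₁ d₁ p₂ u₃ r₃) (rhs τ u₁ r₁ p₁ d₁ u₃ r₃)
  where
  lhs : ∀ τ u₁ r₁ p₁ d₁ p₂ u₃ r₃ →
    τ + (u₁ + p₁ + (d₁ + (τ + (p₁ + p₂) + (u₃ + r₃ + r₁)))) ≡
    2 * τ + u₁ + d₁ + u₃ + r₃ + r₁ + 2 * p₁ + p₂
  lhs = solve-∀
  rhs : ∀ τ u₁ r₁ p₁ d₁ u₃ r₃ →
    u₁ + (d₁ + (3 * p₁ + r₁ + (u₃ + (2 * τ + r₃)))) ≡
    2 * τ + u₁ + d₁ + u₃ + r₃ + r₁ + 2 * p₁ + p₁
  rhs = solve-∀

-- Job 1 is released by `τ` and due no earlier than job 3, hence at least `p₁ + p₂ + p₃` after `τ`.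
-- Tightness of job 1 keeps this sum below `3 * p₁`.
late-rest-shorter : ∀ {τ u₁ r₁ p₁ d₁ p₂ u₃ p₃ d₃} → τ ≤ u₁ → u₁ + r₁ ≤ 2 * τ → d₁ < 3 * p₁ + r₁ →
  τ + (p₁ + p₂) ≤ u₃ → u₃ + p₃ ≤ d₃ → d₃ ≤ d₁ → p₂ + p₃ < p₁ + p₁
late-rest-shorter {τ} {u₁} {r₁} {p₁} {d₁} {p₂} {u₃} {p₃} {d₃} h₁ h₂ h₃ h₄ h₅ h₆ =
  <-by-difference (2 * τ + u₁ + r₁ + d₁ + u₃ + d₃ + p₁)
    (+-mono-≤-< h₁ (+-mono-≤-< h₂ (+-mono-<-≤ h₃ (+-mono-≤ h₄ (+-mono-≤ h₅ h₆)))))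
    (lhs τ u₁ r₁ p₁ d₁ p₂ u₃ p₃ d₃) (rhs τ u₁ r₁ p₁ d₁ u₃ d₃)
  where
  lhs : ∀ τ u₁ r₁ p₁ d₁ p₂ u₃ p₃ d₃ →
    τ + (u₁ + r₁ + (d₁ + (τ + (p₁ + p₂) + (u₃ + p₃ + d₃)))) ≡
    2 * τ + u₁ + r₁ + d₁ + u₃ + d₃ + p₁ + (p₂ + p₃)
  lhs = solve-∀
  rhs : ∀ τ u₁ r₁ p₁ d₁ u₃ d₃ →
    u₁ + (2 * τ + (3 * p₁ + r₁ + (u₃ + (d₃ + d₁)))) ≡
    2 * τ + u₁ + r₁ + d₁ + u₃ + d₃ + p₁ + (p₁ + p₁)
  rhs = solve-∀

-- From here on time is reversed: completion times `c` replace starting times, and deadlines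
-- exchange roles with release dates. So now `d₃ ≤ d₁` gives the bound on `p₂`, and `r₁ ≤ r₃` the
-- one on `p₂ + p₃`.
early-length : ∀ {t q c r p d} → c + q ≤ t → 2 * t ≤ c + d → r + p ≤ c → d < 3 * p + r → q < p
early-length {t} {q} {c} {r} {p} {d} h₁ h₂ h₃ h₄ =
  *-cancelˡ-< 2 q p (<-by-difference (2 * t + 2 * c + r + p + d)
    (+-mono-≤-< h₁ (+-mono-≤-< h₁ (+-mono-≤-< h₂ (+-mono-≤-< h₃ h₄))))
    (lhs t q c r p d) (rhs t c r p d))
  where
  lhs : ∀ t q c r p d → c + q + (c + q + (2 * t + (r + p + d))) ≡ 2 * t + 2 * c + r + p + d + 2 * q
  lhs = solve-∀
  rhs : ∀ t c r p d → t + (t + (c + d + (c + (3 * p + r)))) ≡ 2 * t + 2 * c + r + p + d + 2 * p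
  rhs = solve-∀

early-first-longer : ∀ {t r₁ p₁ d₁ p₂ c₃ d₃} → r₁ + p₁ ≤ t → d₁ < 3 * p₁ + r₁ →
  c₃ + (p₁ + p₂) ≤ t → 2 * t ≤ c₃ + d₃ → d₃ ≤ d₁ → p₂ < p₁
early-first-longer {t} {r₁} {p₁} {d₁} {p₂} {c₃} {d₃} h₁ h₂ h₃ h₄ h₅ =
  <-by-difference (r₁ + d₁ + c₃ + 2 * t + d₃ + 2 * p₁)
    (+-mono-≤-< h₁ (+-mono-<-≤ h₂ (+-mono-≤ h₃ (+-mono-≤ h₄ h₅))))
    (lhs t r₁ p₁ d₁ p₂ c₃ d₃) (rhs t r₁ p₁ d₁ c₃ d₃)
  where
  lhs : ∀ t r₁ p₁ d₁ p₂ c₃ d₃ →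
    r₁ + p₁ + (d₁ + (c₃ + (p₁ + p₂) + (2 * t + d₃))) ≡
    r₁ + d₁ + c₃ + 2 * t + d₃ + 2 * p₁ + p₂
  lhs = solve-∀
  rhs : ∀ t r₁ p₁ d₁ c₃ d₃ →
    t + (3 * p₁ + r₁ + (t + (c₃ + d₃ + d₁))) ≡
    r₁ + d₁ + c₃ + 2 * t + d₃ + 2 * p₁ + p₁
  rhs = solve-∀

early-rest-shorter : ∀ {t c₁ r₁ p₁ d₁ p₂ c₃ r₃ p₃} → c₁ ≤ t → 2 * t ≤ c₁ + d₁ → d₁ < 3 * p₁ + r₁ →
  c₃ + (p₁ + p₂) ≤ t → r₃ + p₃ ≤ c₃ → r₁ ≤ r₃ → p₂ + p₃ < p₁ + p₁
early-rest-shorter {t} {c₁} {r₁} {p₁} {d₁} {p₂} {c₃} {r₃} {p₃} h₁ h₂ h₃ h₄ h₅ h₆ =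
  <-by-difference (2 * t + c₁ + r₁ + d₁ + c₃ + r₃ + p₁)
    (+-mono-≤-< h₁ (+-mono-≤-< h₂ (+-mono-<-≤ h₃ (+-mono-≤ h₄ (+-mono-≤ h₅ h₆)))))
    (lhs t c₁ r₁ p₁ d₁ p₂ c₃ r₃ p₃) (rhs t c₁ r₁ p₁ d₁ c₃ r₃)
  where
  lhs : ∀ t c₁ r₁ p₁ d₁ p₂ c₃ r₃ p₃ →
    c₁ + (2 * t + (d₁ + (c₃ + (p₁ + p₂) + (r₃ + p₃ + r₁)))) ≡
    2 * t + c₁ + r₁ + d₁ + c₃ + r₃ + p₁ + (p₂ + p₃)
  lhs = solve-∀
  rhs : ∀ t c₁ r₁ p₁ d₁ c₃ r₃ →
    t + (c₁ + d₁ + (3 * p₁ + r₁ + (t + (c₃ + r₃)))) ≡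
    2 * t + c₁ + r₁ + d₁ + c₃ + r₃ + p₁ + (p₁ + p₁)
  rhs = solve-∀

-- A tournament has a Hamiltonian path; here on three vertices.
chain-of-three : ∀ {S : A → Set} {_≺_ : A → A → Set} {x y z} →
  (∀ {a b c} → S a → S b → S c → a ≺ b → b ≺ c → ⊥) → S x → S y → S z →
  x ≺ y ⊎ y ≺ x → x ≺ z ⊎ z ≺ x → y ≺ z ⊎ z ≺ y → ⊥
chain-of-three ¬c sx sy sz (inj₁ xy) xz        (inj₁ yz) = ¬c sx sy sz xy yz
chain-of-three ¬c sx sy sz (inj₁ xy) (inj₁ xz) (inj₂ zy) = ¬c sx sz sy xz zy
chain-of-three ¬c sx sy sz (inj₁ xy) (inj₂ zx) (inj₂ zy) = ¬c sz sx sy zx xy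
chain-of-three ¬c sx sy sz (inj₂ yx) (inj₁ xz) yz        = ¬c sy sx sz yx xz
chain-of-three ¬c sx sy sz (inj₂ yx) (inj₂ zx) (inj₁ yz) = ¬c sy sz sx yz zx
chain-of-three ¬c sx sy sz (inj₂ yx) (inj₂ zx) (inj₂ zy) = ¬c sz sy sx zy yx

-- Intervals of processing

-- Slot `v` is the unit of time from `v` to `v + 1`.
Runs : ℕ → ℕ → ℕ → Set
Runs s l v = s ≤ v × v < s + l

runs? : ∀ s l v → Dec (Runs s l v)
runs? s l v = (s ≤? v) ×-dec (v <? s + l)

work : ℕ → ℕ → ℕ → ℕ
work s l t = (t ∸ s) ⊓ l

work-zero : ∀ s l t → t ≤ s → work s l t ≡ 0
work-zero s l t t≤s rewrite m≤n⇒m∸n≡0 t≤s = refl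

work-full : ∀ s l t → s + l ≤ t → work s l t ≡ l
work-full s l t s+l≤t = m≥n⇒m⊓n≡n (m+n≤o⇒m≤o∸n l (≤-trans (≤-reflexive (+-comm l s)) s+l≤t))

∸-<ˡ : ∀ {s l t} → s ≤ t → t < s + l → t ∸ s < l
∸-<ˡ {s} {l} s≤t t<s+l = +-cancelˡ-< s _ _ (≤-<-trans (≤-reflexive (m+[n∸m]≡n s≤t)) t<s+l)

work-suc : ∀ s l t → work s l (suc t) ≡ work s l t + 𝟙 (runs? s l t)
work-suc s l t with s ≤? t
... | no  s≰t rewrite 𝟙-no (runs? s l t) (s≰t ∘ proj₁)
                    | m≤n⇒m∸n≡0 (≰⇒> s≰t) | m≤n⇒m∸n≡0 (<⇒≤ (≰⇒> s≰t)) = refl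
... | yes s≤t with t <? s + l
...   | yes t<s+l rewrite 𝟙-yes (runs? s l t) (s≤t , t<s+l) | +-∸-assoc 1 s≤t
                        | m≤n⇒m⊓n≡m (∸-<ˡ s≤t t<s+l)
                        | m≤n⇒m⊓n≡m (<⇒≤ (∸-<ˡ s≤t t<s+l)) = +-comm 1 _
...   | no  t≮s+l rewrite 𝟙-no (runs? s l t) (t≮s+l ∘ proj₂)
                        | work-full s l t (≮⇒≥ t≮s+l)
                        | work-full s l (suc t) (m≤n⇒m≤1+n (≮⇒≥ t≮s+l)) = sym (+-identityʳ l)

∑-work-suc : ∀ (xs : List A) (s l : A → ℕ) t →
  ∑ xs (λ x → work (s x) (l x) (suc t)) ≡
  ∑ xs (λ x → work (s x) (l x) t) + count (λ x → runs? (s x) (l x) t) xs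
∑-work-suc xs s l t =
  trans (∑-cong xs (λ x → work-suc (s x) (l x) t)) (∑-distrib-+ xs)

-- Greedy schedules

record Placed : Set where
  constructor placed
  field
    idx  : ℕ
    jb   : Job
    mach : ℕ
    st   : ℕ
open Placed

rel due len end : Placed → ℕ
rel k = r (jb k)
due k = d (jb k)
len k = p (jb k)
end k = st k + len k

-- Two jobs of an instance may agree in all data, so the index decides identity.
_#_ : Placed → Placed → Set
k # k′ = idx k ≢ idx k′

-- `e` is the earliest start allowed: `r` for loose jobs, `mid` for tight ones. Greediness is in
-- `blocked`: a delay is excused only by older jobs that keep every machine occupied until the
-- chosen start.
record GreedyStep (e : Job → ℕ) (K : ℕ) (x : Placed) (h : List Placed) : Set where
  field
    e≤st    : e (jb x) ≤ st x
    free    : ∀ {k} → k ∈ h → mach k ≡ mach x → end k ≤ st x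
    blocked : e (jb x) < st x → ∀ μ → μ < K → ∃ λ k → k ∈ h × mach k ≡ μ × st x ≤ end k
    e-mono  : ∀ {k} → k ∈ h → e (jb k) ≤ e (jb x)
    tie     : ∀ {k} → k ∈ h → e (jb k) ≡ e (jb x) → due k ≤ due x
open GreedyStep

-- The most recently placed job comes first.
data Greedy (e : Job → ℕ) (K : ℕ) : List Placed → Set where
  []  : Greedy e K []
  _∷_ : ∀ {x h} → GreedyStep e K x h → Greedy e K h → Greedy e K (x ∷ h)

greedy-e≤st : ∀ {e K h x} → Greedy e K h → x ∈ h → e (jb x) ≤ st x
greedy-e≤st (s ∷ _) (here refl) = e≤st s
greedy-e≤st (_ ∷ g) (there x∈)  = greedy-e≤st g x∈

greedy-disjoint : ∀ {e K h x y} → Greedy e K h → x ∈ h → y ∈ h → x # y → mach x ≡ mach y →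
  end x ≤ st y ⊎ end y ≤ st x
greedy-disjoint (s ∷ _) (here refl) (here refl) x#y _  = contradiction refl x#y
greedy-disjoint (s ∷ _) (here refl) (there y∈)  _   eq = inj₂ (free s y∈ (sym eq))
greedy-disjoint (s ∷ _) (there x∈)  (here refl) _   eq = inj₁ (free s x∈ eq)
greedy-disjoint (_ ∷ g) (there x∈)  (there y∈)  x#y eq = greedy-disjoint g x∈ y∈ x#y eq

-- By `blocked`, machine `μ` has an older job `k` that ends after time `v`. Either `k` runs in slot
-- `v`, or it is itself waiting there, since `e` is no larger for older jobs; then the induction
-- continues with `k`.
waiting⇒all-busy : ∀ {e K h} → Greedy e K h → ∀ {x} → x ∈ h → ∀ {v} →
  e (jb x) ≤ v → v < st x → ∀ μ → μ < K →
  ∃ λ k → k ∈ h × Runs (st k) (len k) v × mach k ≡ μ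
waiting⇒all-busy (s ∷ g) (there x∈) e≤v v<st μ μ<K =
  let (k , k∈ , q) = waiting⇒all-busy g x∈ e≤v v<st μ μ<K in k , there k∈ , q
waiting⇒all-busy (s ∷ g) (here refl) {v} e≤v v<st μ μ<K
  with blocked s (≤-<-trans e≤v v<st) μ μ<K
... | k , k∈ , eq , st≤end with st k ≤? v
...   | yes st≤v = k , there k∈ , (st≤v , <-≤-trans v<st st≤end) , eq
...   | no  st≰v =
  let (k′ , k′∈ , q) = waiting⇒all-busy g k∈ (≤-trans (e-mono s k∈) e≤v) (≰⇒> st≰v) μ μ<K
  in k′ , there k′∈ , q

-- With few busy slots (b + y ≤ D - r) the first bound suffices; otherwise the window bound forces
-- y ≤ 2 b, and the processing of the busy slots pays for the whole interval [r , r + y).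
balance : ∀ O A m b y r D → O ≤ A + m * b → O + m * r + 4 * m * b ≤ A + m * D + m * y →
  3 * y + r ≤ D + 3 * b → O + m * (r + y) ≤ A + m * D
balance O A m b y r D few-busy many-busy window with b + y + r ≤? D
... | yes le = begin
  O + m * (r + y)         ≤⟨ +-monoˡ-≤ _ few-busy ⟩
  A + m * b + m * (r + y) ≡⟨ eq A m b r y ⟩
  A + m * (b + y + r)     ≤⟨ +-monoʳ-≤ A (*-monoʳ-≤ m le) ⟩
  A + m * D               ∎
  where
  open ≤-Reasoning
  eq : ∀ A m b r y → A + m * b + m * (r + y) ≡ A + m * (b + y + r)
  eq = solve-∀
... | no ¬le = +-cancelʳ-≤ (m * y) _ _ (begin
  O + m * (r + y) + m * y     ≡⟨ eq₁ O m r y ⟩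
  O + m * r + m * (2 * y)     ≤⟨ +-monoʳ-≤ (O + m * r) (*-monoʳ-≤ m 2y≤4b) ⟩
  O + m * r + m * (4 * b)     ≡⟨ cong (O + m * r +_) (eq₂ m b) ⟩
  O + m * r + 4 * m * b       ≤⟨ many-busy ⟩
  A + m * D + m * y           ∎)
  where
  open ≤-Reasoning
  eq₁ : ∀ O m r y → O + m * (r + y) + m * y ≡ O + m * r + m * (2 * y)
  eq₁ = solve-∀
  eq₂ : ∀ m b → m * (4 * b) ≡ 4 * m * b
  eq₂ = solve-∀
  eq₃ : ∀ y r → 2 * y + (y + r) ≡ 3 * y + r
  eq₃ = solve-∀
  eq₄ : ∀ b y r → b + y + r + 3 * b ≡ 4 * b + (y + r)
  eq₄ = solve-∀
  2y≤4b : 2 * y ≤ 4 * b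
  2y≤4b = +-cancelʳ-≤ (y + r) _ _ (begin
    2 * y + (y + r)     ≡⟨ eq₃ y r ⟩
    3 * y + r           ≤⟨ window ⟩
    D + 3 * b           ≤⟨ +-monoˡ-≤ _ (<⇒≤ (≰⇒> ¬le)) ⟩
    b + y + r + 3 * b   ≡⟨ eq₄ b y r ⟩
    4 * b + (y + r)     ∎)

-- Starting at `mid` centres the processing in the window, rounded down.
mid : Job → ℕ
mid j = r j + ⌊ d j ∸ r j ∸ p j /2⌋

-- Comparison with a feasible schedule on m machines

module Against
  (m : ℕ) (V : Placed → Set) (om os : Placed → ℕ)
  (om<m  : ∀ k → V k → om k < m)
  (rel≤os : ∀ k → V k → rel k ≤ os k)
  (os≤due : ∀ k → V k → os k + len k ≤ due k)
  (disjoint : ∀ k k′ → V k → V k′ → k # k′ → om k ≡ om k′ →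
              os k + len k ≤ os k′ ⊎ os k′ + len k′ ≤ os k)
  (agree : ∀ k k′ → V k → V k′ → rel k < rel k′ → due k ≤ due k′)
  where

  opt-count : ∀ J → (∀ {k} → k ∈ J → V k) → AllPairs _#_ J → ∀ v →
    count (λ k → runs? (os k) (len k) v) J ≤ m
  opt-count J valid distinct v = ≤-trans
    (count-≤-fibres om (λ k → runs? (os k) (len k) v) J 1 m (λ k∈ _ → om<m _ (valid k∈)) one)
    (≤-reflexive (*-identityʳ m))
    where
    one : ∀ μ → μ < m → count (λ k → runs? (os k) (len k) v ×-dec (om k ≟ μ)) J ≤ 1
    one μ _ = count-≤1 (λ k → runs? (os k) (len k) v ×-dec (om k ≟ μ)) distinct clash
      where
      clash : ∀ {x y} → x ∈ J → y ∈ J →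
        Runs (os x) (len x) v × om x ≡ μ → Runs (os y) (len y) v × om y ≡ μ → ¬ (x # y)
      clash x∈ y∈ ((sx , ex) , μx) ((sy , ey) , μy) x#y
        with disjoint _ _ (valid x∈) (valid y∈) x#y (trans μx (sym μy))
      ... | inj₁ x≺y = <-irrefl refl (<-≤-trans ex (≤-trans x≺y sy))
      ... | inj₂ y≺x = <-irrefl refl (<-≤-trans ey (≤-trans y≺x sx))

  -- Loose jobs

  module Loose
    (J : List Placed) (valid : ∀ {k} → k ∈ J → V k) (distinct : AllPairs _#_ J)
    (greedy : Greedy r (4 * m) J) (D : ℕ) (due≤D : ∀ {k} → k ∈ J → due k ≤ D)
    (loose : ∀ {k} → k ∈ J → 3 * len k + rel k ≤ due k)
    where

    Opt Alg : ℕ → ℕ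
    Opt  t = ∑ J (λ k → work (os k) (len k) t)
    Alg t = ∑ J (λ k → work (st k) (len k) t)

    Busy : ℕ → Set
    Busy v = 4 * m ≤ count (λ k → runs? (st k) (len k) v) J

    busy? : ∀ v → Dec (Busy v)
    busy? v = 4 * m ≤? count (λ k → runs? (st k) (len k) v) J

    busy : ℕ → ℕ → ℕ
    busy t zero    = 0
    busy t (suc x) = busy t x + 𝟙 (busy? (t + x))

    busy-mono : ∀ t {x y} → x ≤ y → busy t x ≤ busy t y
    busy-mono t {x} {zero}  z≤n = z≤n
    busy-mono t {x} {suc y} x≤y with m≤n⇒m<n∨m≡n x≤y
    ... | inj₁ x<y  = ≤-trans (busy-mono t (≤-pred x<y)) (m≤m+n _ _)
    ... | inj₂ refl = ≤-refl

    Alg-gain : ∀ t x → Alg t + 4 * m * busy t x ≤ Alg (t + x)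
    Alg-gain t zero rewrite *-zeroʳ (4 * m) | +-identityʳ t = ≤-reflexive (+-identityʳ _)
    Alg-gain t (suc x) rewrite +-suc t x | ∑-work-suc J st len (t + x) = begin
      Alg t + 4 * m * (busy t x + 𝟙 (busy? (t + x)))
        ≡⟨ cong (Alg t +_) (*-distribˡ-+ (4 * m) (busy t x) _) ⟩
      Alg t + (4 * m * busy t x + 4 * m * 𝟙 (busy? (t + x)))
        ≡⟨ +-assoc (Alg t) _ _ ⟨
      Alg t + 4 * m * busy t x + 4 * m * 𝟙 (busy? (t + x))
        ≤⟨ +-mono-≤ (Alg-gain t x) (slot (busy? (t + x))) ⟩
      Alg (t + x) + count (λ k → runs? (st k) (len k) (t + x)) J ∎
      where
      open ≤-Reasoning
      slot : ∀ {c} → (dec : Dec (4 * m ≤ c)) → 4 * m * 𝟙 dec ≤ c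
      slot (yes q) = ≤-trans (≤-reflexive (*-identityʳ (4 * m))) q
      slot (no _)  = ≤-trans (≤-reflexive (*-zeroʳ (4 * m))) z≤n

    Opt-gain : ∀ t x → Opt (t + x) ≤ Opt t + m * x
    Opt-gain t zero rewrite *-zeroʳ m | +-identityʳ t = ≤-reflexive (sym (+-identityʳ _))
    Opt-gain t (suc x) rewrite +-suc t x | ∑-work-suc J os len (t + x) = begin
      Opt (t + x) + count (λ k → runs? (os k) (len k) (t + x)) J
        ≤⟨ +-mono-≤ (Opt-gain t x) (opt-count J valid distinct (t + x)) ⟩
      Opt t + m * x + m
        ≡⟨ extend (Opt t) m x ⟩
      Opt t + m * (1 + x) ∎
      where
      open ≤-Reasoning
      extend : ∀ o m x → o + m * x + m ≡ o + m * (1 + x)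
      extend = solve-∀

    -- A released job still waiting at `v` would mean a running job on each of the `4 * m` machines.
    idle⇒started : ∀ {v} → ¬ Busy v → ∀ {k} → k ∈ J → rel k ≤ v → st k ≤ v
    idle⇒started {v} ¬busy {k} k∈ rel≤v = ≮⇒≥ λ v<st →
      ¬busy (count-≥-fibres mach (λ k → runs? (st k) (len k) v) J (4 * m)
        (waiting⇒all-busy greedy k∈ rel≤v v<st))

    waiting⇒busy : ∀ {k} → k ∈ J → ∀ x → rel k + x ≤ st k → x ≤ busy (rel k) x
    waiting⇒busy {k} k∈ zero    le = z≤n
    waiting⇒busy {k} k∈ (suc x) le = begin
      suc x                                        ≡⟨ +-comm 1 x ⟩
      x + 1                                        ≤⟨ +-mono-≤ (waiting⇒busy k∈ x (<⇒≤ le′)) (≤-reflexive (sym (𝟙-yes (busy? (rel k + x)) busyx))) ⟩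
      busy (rel k) x + 𝟙 (busy? (rel k + x))       ∎
      where
      open ≤-Reasoning
      le′ : rel k + x < st k
      le′ = ≤-trans (≤-reflexive (sym (+-suc (rel k) x))) le
      busyx : Busy (rel k + x)
      busyx with busy? (rel k + x)
      ... | yes q = q
      ... | no ¬q = contradiction (idle⇒started ¬q k∈ (m≤m+n _ x)) (<⇒≱ le′)

    -- What the optimum processes of `k` in the busy slots of [t , t + x), the only ones in which it
    -- can gain on an unfinished job.
    stolen : ℕ → ℕ → Placed → ℕ
    stolen t zero    k = 0
    stolen t (suc x) k = stolen t x k + 𝟙 (busy? (t + x) ×-dec runs? (os k) (len k) (t + x))

    ∑-stolen : ∀ t x → ∑ J (stolen t x) ≤ m * busy t x
    ∑-stolen t zero    = ≤-trans (≤-reflexive (zeros J)) z≤n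
      where
      zeros : ∀ (xs : List Placed) → ∑ xs (stolen t zero) ≡ 0
      zeros []       = refl
      zeros (_ ∷ xs) = zeros xs
    ∑-stolen t (suc x) = begin
      ∑ J (stolen t (suc x))
        ≡⟨ ∑-distrib-+ J ⟩
      ∑ J (stolen t x) + count (λ k → busy? (t + x) ×-dec runs? (os k) (len k) (t + x)) J
        ≤⟨ +-mono-≤ (∑-stolen t x) (slot (busy? (t + x))) ⟩
      m * busy t x + m * 𝟙 (busy? (t + x))
        ≡⟨ *-distribˡ-+ m (busy t x) _ ⟨
      m * (busy t x + 𝟙 (busy? (t + x))) ∎
      where
      open ≤-Reasoning
      slot : ∀ {X : Set} (dec : Dec X) →
        count (λ k → dec ×-dec runs? (os k) (len k) (t + x)) J ≤ m * 𝟙 dec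
      slot (yes _) = ≤-trans (opt-count J valid distinct (t + x)) (≤-reflexive (sym (*-identityʳ m)))
      slot (no ¬q) = ≤-trans (≤-reflexive (count-none (λ k → no ¬q ×-dec runs? (os k) (len k) (t + x)) J (λ _ → ¬q ∘ proj₁))) z≤n

    -- In an idle slot every released unfinished job runs, so the optimum gains on it only in busy slots.
    unfinished-lead : ∀ {k} → k ∈ J → ∀ t x → t ≤ rel k → t + x ≤ end k →
      work (os k) (len k) (t + x) ≤ work (st k) (len k) (t + x) + stolen t x k
    unfinished-lead {k} k∈ t zero t≤rel _ =
      ≤-trans (≤-reflexive (work-zero (os k) (len k) (t + 0)
        (≤-trans (≤-reflexive (+-identityʳ t)) (≤-trans t≤rel (rel≤os _ (valid k∈)))))) z≤n
    unfinished-lead {k} k∈ t (suc x) t≤rel le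
      rewrite +-suc t x | work-suc (os k) (len k) (t + x) | work-suc (st k) (len k) (t + x) = begin
      work (os k) (len k) v + 𝟙 (runs? (os k) (len k) v)
        ≤⟨ +-mono-≤ (unfinished-lead k∈ t x t≤rel (<⇒≤ le)) (slot (busy? v)) ⟩
      work (st k) (len k) v + stolen t x k + (𝟙 (runs? (st k) (len k) v) + 𝟙 (busy? v ×-dec runs? (os k) (len k) v))
        ≡⟨ interchange (work (st k) (len k) v) _ _ _ ⟩
      work (st k) (len k) v + 𝟙 (runs? (st k) (len k) v) + (stolen t x k + 𝟙 (busy? v ×-dec runs? (os k) (len k) v)) ∎
      where
      open ≤-Reasoning
      v = t + x
      interchange : ∀ a b c d → a + b + (c + d) ≡ a + c + (b + d)
      interchange = solve-∀
      slot : (dec : Dec (Busy v)) →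
        𝟙 (runs? (os k) (len k) v) ≤ 𝟙 (runs? (st k) (len k) v) + 𝟙 (dec ×-dec runs? (os k) (len k) v)
      slot (yes _)    = m≤n+m _ _
      slot (no ¬busy) = ≤-trans
        (𝟙-mono (runs? (os k) (len k) v) (runs? (st k) (len k) v)
          (λ (os≤v , _) → idle⇒started ¬busy k∈ (≤-trans (rel≤os _ (valid k∈)) os≤v) , le))
        (m≤m+n _ _)

    -- The backlog of the algorithm exceeds that of the optimum by at most m (D - t).
    Lead : ℕ → Set
    Lead t = Opt t + m * t ≤ Alg t + m * D

    -- The optimum gains at most `m` in the slot and the allowance m (D - t) shrinks by `m`; the
    -- algorithm gains at least `4 * m`.
    lead-busy : ∀ t → Busy t → Lead t → Lead (suc t)
    lead-busy t bt le rewrite ∑-work-suc J os len t | ∑-work-suc J st len t = begin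
      Opt t + co + m * (1 + t)      ≤⟨ +-monoˡ-≤ _ (+-monoʳ-≤ (Opt t) (opt-count J valid distinct t)) ⟩
      Opt t + m + m * (1 + t)       ≡⟨ extend (Opt t) m t ⟩
      Opt t + m * t + 2 * m         ≤⟨ +-mono-≤ le (≤-trans (*-monoˡ-≤ m (s≤s (s≤s (z≤n {2})))) bt) ⟩
      Alg t + m * D + ca           ≡⟨ rearrange (Alg t) (m * D) ca ⟩
      Alg t + ca + m * D           ∎
      where
      open ≤-Reasoning
      co = count (λ k → runs? (os k) (len k) t) J
      ca = count (λ k → runs? (st k) (len k) t) J
      extend : ∀ o m t → o + m + m * (1 + t) ≡ o + m * t + 2 * m
      extend = solve-∀
      rearrange : ∀ a b c → a + b + c ≡ a + c + b
      rearrange = solve-∀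

    Unfinished : ℕ → Placed → Set
    Unfinished u k = rel k ≤ u × suc u < end k

    unfinished? : ∀ u → Decidable (Unfinished u)
    unfinished? u k = (rel k ≤? u) ×-dec (suc u <? end k)

    finished-lead : ∀ u {k} → k ∈ J → ¬ Unfinished u k →
      work (os k) (len k) (suc u) ≤ work (st k) (len k) (suc u)
    finished-lead u {k} k∈ ¬unf with rel k ≤? u
    ... | no  rel≰u = ≤-trans (≤-reflexive (work-zero (os k) (len k) (suc u)
                        (≤-trans (≰⇒> rel≰u) (rel≤os _ (valid k∈))))) z≤n
    ... | yes rel≤u = ≤-trans (m⊓n≤n _ (len k)) (≤-reflexive (sym (work-full (st k) (len k) (suc u)
                        (≮⇒≥ (λ lt → ¬unf (rel≤u , lt))))))

    lead-idle : ∀ u → suc u ≤ D → ¬ Busy u → (∀ t → t ≤ u → Lead t) → Lead (suc u)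
    lead-idle u u<D ¬busy ih with minimal rel (unfinished? u) J
    -- Without unfinished jobs the algorithm is nowhere behind the optimum, and `suc u ≤ D` leaves a
    -- nonnegative allowance.
    ... | inj₁ none = +-mono-≤ (∑-mono J (λ k∈ → finished-lead u k∈ (none k∈))) (*-monoʳ-≤ m u<D)
    ... | inj₂ (k , k∈ , (rel≤u , u<end) , first) =
      subst Lead t≡ (balance (Opt (r₀ + y)) (Alg (r₀ + y)) m b y r₀ D few-busy many-busy window)
      where
      open ≤-Reasoning
      r₀ = rel k
      y  = suc u ∸ r₀
      b  = busy r₀ y
      t≡ : r₀ + y ≡ suc u
      t≡ = m+[n∸m]≡n (m≤n⇒m≤1+n rel≤u)

      leads : ∀ {i} → i ∈ J →
        work (os i) (len i) (r₀ + y) ≤ work (st i) (len i) (r₀ + y) + stolen r₀ y i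
      leads {i} i∈ with unfinished? u i
      ... | yes unf = unfinished-lead i∈ r₀ y (first i∈ unf) (≤-trans (≤-reflexive t≡) (<⇒≤ (proj₂ unf)))
      ... | no ¬unf = ≤-trans
        (subst (λ t → work (os i) (len i) t ≤ work (st i) (len i) t) (sym t≡) (finished-lead u i∈ ¬unf))
        (m≤m+n _ _)

      few-busy : Opt (r₀ + y) ≤ Alg (r₀ + y) + m * b
      few-busy = begin
        Opt (r₀ + y)                         ≤⟨ ∑-mono J leads ⟩
        ∑ J (λ i → work (st i) (len i) (r₀ + y) + stolen r₀ y i) ≡⟨ ∑-distrib-+ J ⟩
        Alg (r₀ + y) + ∑ J (stolen r₀ y)    ≤⟨ +-monoʳ-≤ _ (∑-stolen r₀ y) ⟩
        Alg (r₀ + y) + m * b                ∎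

      -- The claim at `r₀`, followed by `y` slots in which the optimum gains at most `m * y` and the
      -- algorithm at least `4 * m * b`.
      many-busy : Opt (r₀ + y) + m * r₀ + 4 * m * b ≤ Alg (r₀ + y) + m * D + m * y
      many-busy = begin
        Opt (r₀ + y) + m * r₀ + 4 * m * b      ≤⟨ +-monoˡ-≤ _ (+-monoˡ-≤ _ (Opt-gain r₀ y)) ⟩
        Opt r₀ + m * y + m * r₀ + 4 * m * b    ≡⟨ rearrange₁ (Opt r₀) (m * y) (m * r₀) (4 * m * b) ⟩
        Opt r₀ + m * r₀ + (m * y + 4 * m * b)  ≤⟨ +-monoˡ-≤ _ (ih r₀ rel≤u) ⟩
        Alg r₀ + m * D + (m * y + 4 * m * b)  ≡⟨ rearrange₂ (Alg r₀) (m * D) (m * y) (4 * m * b) ⟩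
        Alg r₀ + 4 * m * b + (m * D + m * y)  ≤⟨ +-monoˡ-≤ _ (Alg-gain r₀ y) ⟩
        Alg (r₀ + y) + (m * D + m * y)        ≡⟨ +-assoc _ (m * D) (m * y) ⟨
        Alg (r₀ + y) + m * D + m * y          ∎
        where
        rearrange₁ : ∀ a b c d → a + b + c + d ≡ a + c + (b + d)
        rearrange₁ = solve-∀
        rearrange₂ : ∀ a b c d → a + b + (c + d) ≡ a + d + (b + c)
        rearrange₂ = solve-∀

      z = st k ∸ r₀
      st≡ : r₀ + z ≡ st k
      st≡ = m+[n∸m]≡n (greedy-e≤st greedy k∈)
      -- `k` waits only in busy slots, and as slot `u` is idle its waiting is over by then.
      z≤b : z ≤ b
      z≤b = ≤-trans (waiting⇒busy k∈ z (≤-reflexive st≡))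
                    (busy-mono r₀ (∸-monoˡ-≤ r₀ (m≤n⇒m≤1+n (idle⇒started ¬busy k∈ rel≤u))))

      -- `k` is unfinished at `suc u`, so the time since `r₀` consists of its waiting and part of
      -- its processing.
      y≤b+len : y ≤ b + len k
      y≤b+len = +-cancelˡ-≤ r₀ _ _ (begin
        r₀ + y               ≡⟨ t≡ ⟩
        suc u                ≤⟨ <⇒≤ u<end ⟩
        st k + len k         ≡⟨ cong (_+ len k) st≡ ⟨
        r₀ + z + len k       ≤⟨ +-monoˡ-≤ _ (+-monoʳ-≤ r₀ z≤b) ⟩
        r₀ + b + len k       ≡⟨ +-assoc r₀ b (len k) ⟩
        r₀ + (b + len k)     ∎)

      window : 3 * y + r₀ ≤ D + 3 * b
      window = begin
        3 * y + r₀                  ≤⟨ +-monoˡ-≤ r₀ (*-monoʳ-≤ 3 y≤b+len) ⟩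
        3 * (b + len k) + r₀        ≡⟨ rearrange b (len k) r₀ ⟩
        3 * len k + r₀ + 3 * b      ≤⟨ +-monoˡ-≤ _ (≤-trans (loose k∈) (due≤D k∈)) ⟩
        D + 3 * b                   ∎
        where
        rearrange : ∀ b l r → 3 * (b + l) + r ≡ 3 * l + r + 3 * b
        rearrange = solve-∀

    lead-upto : ∀ u → u ≤ D → ∀ t → t ≤ u → Lead t
    lead-upto zero    _   zero    _ = +-mono-≤
      (∑-mono J (λ {k} _ → ≤-trans (≤-reflexive (work-zero (os k) (len k) 0 z≤n)) z≤n)) (*-monoʳ-≤ m z≤n)
    lead-upto (suc u) u<D t t≤ with m≤n⇒m<n∨m≡n t≤
    ... | inj₁ t<su = lead-upto u (<⇒≤ u<D) t (≤-pred t<su)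
    ... | inj₂ refl with busy? u
    ...   | yes bu  = lead-busy u bu (lead-upto u (<⇒≤ u<D) u ≤-refl)
    ...   | no ¬bu = lead-idle u u<D ¬bu (lead-upto u (<⇒≤ u<D))

    meets-deadline : ∀ {j} → j ∈ J → due j ≡ D → end j ≤ due j
    meets-deadline {j} j∈ refl = begin
      st j + len j         ≡⟨ cong (_+ len j) st≡ ⟨
      rel j + z + len j    ≡⟨ +-assoc (rel j) z (len j) ⟩
      rel j + (z + len j)  ≤⟨ +-monoʳ-≤ (rel j) z+len≤L ⟩
      rel j + L            ≡⟨ D≡ ⟩
      D                    ∎
      where
      open ≤-Reasoning
      rel≤D : rel j ≤ D
      rel≤D = ≤-trans (m≤n+m (rel j) (3 * len j)) (loose j∈)
      z = st j ∸ rel j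
      L = D ∸ rel j
      st≡ : rel j + z ≡ st j
      st≡ = m+[n∸m]≡n (greedy-e≤st greedy j∈)
      D≡ : rel j + L ≡ D
      D≡ = m+[n∸m]≡n rel≤D

      total≤Opt : ∑ J len ≤ Opt D
      total≤Opt = ∑-mono J λ {k} k∈ → ≤-reflexive (sym (work-full (os k) (len k) D
        (≤-trans (os≤due _ (valid k∈)) (due≤D k∈))))

      -- In the `z` busy slots of waiting the algorithm does at least `4 * m * z`, and its total is
      -- at most what the optimum completes by `D`. From `rel j` on the optimum does at most
      -- `m * L`; the claim at `rel j` adds another `m * L`.
      volume : m * (4 * z) ≤ m * (2 * L)
      volume = +-cancelˡ-≤ (Alg (rel j) + m * rel j) _ _ (begin
        Alg (rel j) + m * rel j + m * (4 * z)   ≡⟨ rearrange₁ (Alg (rel j)) m (rel j) z ⟩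
        Alg (rel j) + 4 * m * z + m * rel j     ≤⟨ +-monoˡ-≤ _ (+-monoʳ-≤ (Alg (rel j)) (*-monoʳ-≤ (4 * m) (waiting⇒busy j∈ z (≤-reflexive st≡)))) ⟩
        Alg (rel j) + 4 * m * busy (rel j) z + m * rel j ≤⟨ +-monoˡ-≤ _ (Alg-gain (rel j) z) ⟩
        Alg (rel j + z) + m * rel j             ≤⟨ +-monoˡ-≤ _ (∑-mono J (λ {k} _ → m⊓n≤n _ (len k))) ⟩
        ∑ J len + m * rel j                    ≤⟨ +-monoˡ-≤ _ total≤Opt ⟩
        Opt D + m * rel j                        ≡⟨ cong (λ t → Opt t + m * rel j) D≡ ⟨
        Opt (rel j + L) + m * rel j              ≤⟨ +-monoˡ-≤ _ (Opt-gain (rel j) L) ⟩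
        Opt (rel j) + m * L + m * rel j          ≡⟨ rearrange₂ (Opt (rel j)) (m * L) (m * rel j) ⟩
        Opt (rel j) + m * rel j + m * L          ≤⟨ +-monoˡ-≤ _ (lead-upto D ≤-refl (rel j) rel≤D) ⟩
        Alg (rel j) + m * D + m * L             ≡⟨ cong (λ t → Alg (rel j) + m * t + m * L) D≡ ⟨
        Alg (rel j) + m * (rel j + L) + m * L   ≡⟨ rearrange₃ (Alg (rel j)) m (rel j) L ⟩
        Alg (rel j) + m * rel j + m * (2 * L)   ∎)
        where
        rearrange₁ : ∀ a m r z → a + m * r + m * (4 * z) ≡ a + 4 * m * z + m * r
        rearrange₁ = solve-∀
        rearrange₂ : ∀ a b c → a + b + c ≡ a + c + b
        rearrange₂ = solve-∀
        rearrange₃ : ∀ a m r l → a + m * (r + l) + m * l ≡ a + m * r + m * (2 * l)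
        rearrange₃ = solve-∀

      4z≤2L : 4 * z ≤ 2 * L
      -- The optimum puts `j` on a machine below `m`, so `m` is positive.
      4z≤2L = *-cancelˡ-≤ m {{>-nonZero (≤-<-trans z≤n (om<m _ (valid j∈)))}} volume

      3len≤L : 3 * len j ≤ L
      3len≤L = m+n≤o⇒m≤o∸n (3 * len j) (loose j∈)

      -- The wait is at most L / 2 and the length at most L / 3; the factor 6 clears denominators.
      z+len≤L : z + len j ≤ L
      z+len≤L = *-cancelˡ-≤ 6 (begin
        6 * (z + len j)               ≤⟨ m≤n+m _ (2 * z) ⟩
        2 * z + 6 * (z + len j)       ≡⟨ rearrange₁ z (len j) ⟩
        2 * (4 * z) + 2 * (3 * len j) ≤⟨ +-mono-≤ (*-monoʳ-≤ 2 4z≤2L) (*-monoʳ-≤ 2 3len≤L) ⟩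
        2 * (2 * L) + 2 * L           ≡⟨ rearrange₂ L ⟩
        6 * L                         ∎)
        where
        rearrange₁ : ∀ z l → 2 * z + 6 * (z + l) ≡ 2 * (4 * z) + 2 * (3 * l)
        rearrange₁ = solve-∀
        rearrange₂ : ∀ l → 2 * (2 * l) + 2 * l ≡ 6 * l
        rearrange₂ = solve-∀

  -- Each job is judged in the list up to its own placement, which later jobs do not change. Its
  -- deadline is the largest there, by agreeability or, among equal release dates, by the
  -- tie-breaking.
  loose-deadlines : ∀ {H} → Greedy r (4 * m) H → AllPairs _#_ H → (∀ {k} → k ∈ H → V k) →
    (∀ {k} → k ∈ H → 3 * len k + rel k ≤ due k) → ∀ {j} → j ∈ H → end j ≤ due j
  loose-deadlines (_ ∷ g) (_ ∷ ds) valid loose (there j∈) =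
    loose-deadlines g ds (valid ∘ there) (loose ∘ there) j∈
  loose-deadlines {x ∷ h} (s ∷ g) ds valid loose (here refl) =
    Loose.meets-deadline (x ∷ h) valid ds (s ∷ g) (due x) due≤ loose (here refl) refl
    where
    due≤ : ∀ {k} → k ∈ x ∷ h → due k ≤ due x
    due≤ (here refl) = ≤-refl
    due≤ (there k∈) with m≤n⇒m<n∨m≡n (e-mono s k∈)
    ... | inj₁ rel< = agree _ _ (valid (there k∈)) (valid (here refl)) rel<
    ... | inj₂ rel≡ = tie s k∈ rel≡

  -- Tight jobs

  mid-bounds : ∀ {k} → V k →
    2 * mid (jb k) + len k ≤ rel k + due k × rel k + due k ≤ 2 * mid (jb k) + len k + 1
  mid-bounds {k} vk = lower , upper
    where
    open ≤-Reasoning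
    s = due k ∸ rel k ∸ len k
    -- The optimum processes `k` within its window, so the truncated subtractions in `mid` are
    -- exact.
    fits : rel k + len k ≤ due k
    fits = ≤-trans (+-monoˡ-≤ (len k) (rel≤os _ vk)) (os≤due _ vk)
    due≡ : rel k + len k + s ≡ due k
    due≡ = trans (cong (rel k + len k +_) (∸-+-assoc (due k) (rel k) (len k))) (m+[n∸m]≡n fits)
    s-split : s ≡ ⌊ s /2⌋ + ⌈ s /2⌉
    s-split = sym (⌊n/2⌋+⌈n/2⌉≡n s)
    ceil≤ : ∀ n → ⌈ n /2⌉ ≤ ⌊ n /2⌋ + 1
    ceil≤ zero          = z≤n
    ceil≤ (suc zero)    = ≤-refl
    ceil≤ (suc (suc n)) = s≤s (ceil≤ n)
    rearrange : ∀ r l h c → r + (r + l + (h + c)) ≡ 2 * r + l + h + c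
    rearrange = solve-∀
    split : rel k + due k ≡ 2 * rel k + len k + ⌊ s /2⌋ + ⌈ s /2⌉
    split = begin-equality
      rel k + due k                             ≡⟨ cong (rel k +_) due≡ ⟨
      rel k + (rel k + len k + s)               ≡⟨ cong (λ z → rel k + (rel k + len k + z)) s-split ⟩
      rel k + (rel k + len k + (⌊ s /2⌋ + ⌈ s /2⌉)) ≡⟨ rearrange (rel k) (len k) ⌊ s /2⌋ ⌈ s /2⌉ ⟩
      2 * rel k + len k + ⌊ s /2⌋ + ⌈ s /2⌉     ∎
    double : ∀ r l h → 2 * (r + h) + l ≡ 2 * r + l + h + h
    double = solve-∀
    lower : 2 * mid (jb k) + len k ≤ rel k + due k
    lower = begin
      2 * (rel k + ⌊ s /2⌋) + len k             ≡⟨ double (rel k) (len k) ⌊ s /2⌋ ⟩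
      2 * rel k + len k + ⌊ s /2⌋ + ⌊ s /2⌋     ≤⟨ +-monoʳ-≤ _ (⌊n/2⌋≤⌈n/2⌉ s) ⟩
      2 * rel k + len k + ⌊ s /2⌋ + ⌈ s /2⌉     ≡⟨ split ⟨
      rel k + due k                             ∎
    upper : rel k + due k ≤ 2 * mid (jb k) + len k + 1
    upper = begin
      rel k + due k                             ≡⟨ split ⟩
      2 * rel k + len k + ⌊ s /2⌋ + ⌈ s /2⌉     ≤⟨ +-monoʳ-≤ _ (ceil≤ s) ⟩
      2 * rel k + len k + ⌊ s /2⌋ + (⌊ s /2⌋ + 1) ≡⟨ +-assoc (2 * rel k + len k + ⌊ s /2⌋) _ 1 ⟨
      2 * rel k + len k + ⌊ s /2⌋ + ⌊ s /2⌋ + 1 ≡⟨ cong (_+ 1) (double (rel k) (len k) ⌊ s /2⌋) ⟨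
      2 * (rel k + ⌊ s /2⌋) + len k + 1         ∎

  mid-fits : ∀ {k} → V k → mid (jb k) + len k ≤ due k
  mid-fits {k} vk = +-cancelˡ-≤ (rel k) _ _ (begin
    rel k + (mid (jb k) + len k)          ≤⟨ +-monoˡ-≤ _ (m≤m+n (rel k) _) ⟩
    mid (jb k) + (mid (jb k) + len k)     ≡⟨ double (mid (jb k)) (len k) ⟩
    2 * mid (jb k) + len k                ≤⟨ proj₁ (mid-bounds vk) ⟩
    rel k + due k                         ∎)
    where
    open ≤-Reasoning
    double : ∀ e l → e + (e + l) ≡ 2 * e + l
    double = solve-∀

  module Tight
    (J : List Placed) (valid : ∀ {k} → k ∈ J → V k) (distinct : AllPairs _#_ J)
    (tight : ∀ {k} → k ∈ J → due k < 3 * len k + rel k) (t μ : ℕ)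
    where

    -- In the optimum, `Early` jobs are over when slot `t` begins and `Late` ones start at `suc t`
    -- or later. The others run in the slot, so one machine has at most one of them.
    Here Early Late : Placed → Set
    Here  k = Runs (mid (jb k)) (len k) t × om k ≡ μ
    Early k = os k + len k ≤ t
    Late  k = t < os k

    here? : Decidable Here
    here? k = runs? (mid (jb k)) (len k) t ×-dec (om k ≟ μ)
    early? : Decidable Early
    early? k = os k + len k ≤? t
    late? : Decidable Late
    late? k = t <? os k

    before? : Decidable (λ k → Here k × Early k)
    before? k = here? k ×-dec early? k
    rest? : Decidable (λ k → Here k × ¬ Early k)
    rest? k = here? k ×-dec ¬? (early? k)
    after? : Decidable (λ k → (Here k × ¬ Early k) × Late k)
    after? k = rest? k ×-dec late? k
    across? : Decidable (λ k → (Here k × ¬ Early k) × ¬ Late k)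
    across? k = rest? k ×-dec ¬? (late? k)

    _≺_ : Placed → Placed → Set
    k ≺ k′ = os k + len k ≤ os k′

    ordered : ∀ {x y} → x ∈ J → y ∈ J → Here x → Here y → x # y → x ≺ y ⊎ y ≺ x
    ordered x∈ y∈ (_ , μx) (_ , μy) x#y = disjoint _ _ (valid x∈) (valid y∈) x#y (trans μx (sym μy))

    started : ∀ {k} → k ∈ J → rel k + len k ≤ os k + len k
    started {k} k∈ = +-monoˡ-≤ (len k) (rel≤os _ (valid k∈))

    successive : ∀ {τ x y z} → τ ≤ os x → x ≺ y → y ≺ z → τ + (len x + len y) ≤ os z
    successive {τ} {x} {y} {z} τ≤x x≺y y≺z = begin
      τ + (len x + len y)  ≡⟨ +-assoc τ (len x) (len y) ⟨
      τ + len x + len y    ≤⟨ +-monoˡ-≤ (len y) (+-monoˡ-≤ (len x) τ≤x) ⟩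
      os x + len x + len y ≤⟨ +-monoˡ-≤ (len y) x≺y ⟩
      os y + len y         ≤⟨ y≺z ⟩
      os z                 ∎
      where open ≤-Reasoning

    successive′ : ∀ {τ x y z} → z ≺ y → y ≺ x → os x + len x ≤ τ → os z + len z + (len x + len y) ≤ τ
    successive′ {τ} {x} {y} {z} z≺y y≺x x≤τ = begin
      os z + len z + (len x + len y) ≤⟨ +-monoˡ-≤ _ z≺y ⟩
      os y + (len x + len y)         ≡⟨ cong (os y +_) (+-comm (len x) (len y)) ⟩
      os y + (len y + len x)         ≡⟨ +-assoc (os y) (len y) (len x) ⟨
      os y + len y + len x           ≤⟨ +-monoˡ-≤ (len x) y≺x ⟩
      os x + len x                   ≤⟨ x≤τ ⟩
      τ                              ∎
      where open ≤-Reasoning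

    -- The release date and the latest start d - p are symmetric about `mid`, which is at most `t`.
    -- Rounding costs one unit, absorbed by using the late lemmas with `suc t` for `τ`.
    late-latest : ∀ {k} → k ∈ J → Here k → os k + rel k ≤ 2 * suc t
    late-latest {k} k∈ ((mid≤t , _) , _) = +-cancelʳ-≤ (len k) _ _ (begin
      os k + rel k + len k             ≡⟨ swap (os k) (rel k) (len k) ⟩
      rel k + (os k + len k)           ≤⟨ +-monoʳ-≤ (rel k) (os≤due _ (valid k∈)) ⟩
      rel k + due k                    ≤⟨ proj₂ (mid-bounds (valid k∈)) ⟩
      2 * mid (jb k) + len k + 1       ≤⟨ +-monoˡ-≤ 1 (+-monoˡ-≤ (len k) (*-monoʳ-≤ 2 mid≤t)) ⟩
      2 * t + len k + 1                ≤⟨ m≤m+n _ 1 ⟩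
      2 * t + len k + 1 + 1            ≡⟨ double t (len k) ⟩
      2 * (1 + t) + len k              ∎)
      where
      open ≤-Reasoning
      swap : ∀ u r l → u + r + l ≡ r + (u + l)
      swap = solve-∀
      double : ∀ t l → 2 * t + l + 1 + 1 ≡ 2 * (1 + t) + l
      double = solve-∀

    -- The earliest completion r + p and the deadline are symmetric about the end of the centred
    -- interval, which lies beyond `t`; rounding down only helps.
    early-earliest : ∀ {k} → k ∈ J → Here k → 2 * t ≤ os k + len k + due k
    early-earliest {k} k∈ ((_ , t<end) , _) = begin
      2 * t                                ≤⟨ *-monoʳ-≤ 2 (<⇒≤ t<end) ⟩
      2 * (mid (jb k) + len k)             ≡⟨ double (mid (jb k)) (len k) ⟩
      2 * mid (jb k) + len k + len k       ≤⟨ +-monoˡ-≤ (len k) (proj₁ (mid-bounds (valid k∈))) ⟩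
      rel k + due k + len k                ≤⟨ +-monoˡ-≤ (len k) (+-monoˡ-≤ (due k) (rel≤os _ (valid k∈))) ⟩
      os k + due k + len k                 ≡⟨ swap (os k) (due k) (len k) ⟩
      os k + len k + due k                 ∎
      where
      open ≤-Reasoning
      double : ∀ e l → 2 * (e + l) ≡ 2 * e + l + l
      double = solve-∀
      swap : ∀ u d l → u + d + l ≡ u + l + d
      swap = solve-∀

    -- By `late-length`, `x` is shorter than `y`, and both together are shorter than `z`.
    -- Agreeability gives `rel x ≤ rel z` or `due z ≤ due x`, and either makes `x` too long for
    -- this.
    late-chain : ∀ {x y z} → x ∈ J × Here x × Late x → y ∈ J × Here y × Late y → z ∈ J × Here z × Late z →
      x ≺ y → y ≺ z → ⊥
    late-chain {x} {y} {z} (x∈ , hx , t<x) (y∈ , hy , _) (z∈ , hz , _) x≺y y≺z with rel x ≤? rel z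
    ... | yes r≤ = <-asym x<y
      (late-first-longer {p₁ = len x} {p₂ = len y} t<x (os≤due _ (valid x∈)) (tight x∈) xy≤z (late-latest z∈ hz) r≤)
      where
      xy≤z = successive t<x x≺y y≺z
      x<y : len x < len y
      x<y  = late-length {p = len y} (≤-trans (+-monoˡ-≤ (len x) t<x) x≺y) (late-latest y∈ hy) (os≤due _ (valid y∈)) (tight y∈)
    ... | no r≰ = <-asym (+-mono-< x<y (≤-<-trans (m≤m+n (len x) (len y)) xy<z))
      (late-rest-shorter {p₁ = len x} {p₂ = len y} t<x (late-latest x∈ hx) (tight x∈) xy≤z (os≤due _ (valid z∈))
        (agree _ _ (valid z∈) (valid x∈) (≰⇒> r≰)))
      where
      xy≤z = successive t<x x≺y y≺z
      x<y : len x < len y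
      x<y  = late-length {p = len y} (≤-trans (+-monoˡ-≤ (len x) t<x) x≺y) (late-latest y∈ hy) (os≤due _ (valid y∈)) (tight y∈)
      xy<z : len x + len y < len z
      xy<z = late-length {p = len z} xy≤z (late-latest z∈ hz) (os≤due _ (valid z∈)) (tight z∈)

    -- The names are bound in reverse, so that `x` is again the job next to slot `t`.
    early-chain : ∀ {x y z} → x ∈ J × Here x × Early x → y ∈ J × Here y × Early y → z ∈ J × Here z × Early z →
      x ≺ y → y ≺ z → ⊥
    early-chain {z} {y} {x} (z∈ , hz , _) (y∈ , hy , _) (x∈ , hx , x≤t) z≺y y≺x with rel x ≤? rel z
    ... | yes r≤ = <-asym (+-mono-< x<y (≤-<-trans (m≤m+n (len x) (len y)) xy<z))
      (early-rest-shorter {p₁ = len x} {p₂ = len y} x≤t (early-earliest x∈ hx) (tight x∈) xy≤t (started z∈) r≤)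
      where
      xy≤t = successive′ z≺y y≺x x≤t
      x<y : len x < len y
      x<y  = early-length {p = len y} (≤-trans (+-monoˡ-≤ (len x) y≺x) x≤t) (early-earliest y∈ hy) (started y∈) (tight y∈)
      xy<z : len x + len y < len z
      xy<z = early-length {p = len z} xy≤t (early-earliest z∈ hz) (started z∈) (tight z∈)
    ... | no r≰ = <-asym x<y
      (early-first-longer {p₁ = len x} {p₂ = len y} (≤-trans (started x∈) x≤t) (tight x∈) xy≤t (early-earliest z∈ hz)
        (agree _ _ (valid z∈) (valid x∈) (≰⇒> r≰)))
      where
      xy≤t = successive′ z≺y y≺x x≤t
      x<y : len x < len y
      x<y  = early-length {p = len y} (≤-trans (+-monoˡ-≤ (len x) y≺x) x≤t) (early-earliest y∈ hy) (started y∈) (tight y∈)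

    at-most-two : ∀ {S : Placed → Set} (S? : Decidable S) →
      (∀ {k} → S k → Here k) →
      (∀ {x y z} → x ∈ J × S x → y ∈ J × S y → z ∈ J × S z → x ≺ y → y ≺ z → ⊥) →
      count S? J ≤ 2
    at-most-two {S} S? S⇒here no-chain = count-≤2 S? distinct
      λ x∈ y∈ z∈ sx sy sz x#y x#z y#z →
        chain-of-three {S = λ k → k ∈ J × S k} {_≺_ = _≺_} no-chain (x∈ , sx) (y∈ , sy) (z∈ , sz)
          (ordered x∈ y∈ (S⇒here sx) (S⇒here sy) x#y)
          (ordered x∈ z∈ (S⇒here sx) (S⇒here sz) x#z)
          (ordered y∈ z∈ (S⇒here sy) (S⇒here sz) y#z)

    machine-count : count here? J ≤ 5
    machine-count = begin
      count here? J                                        ≡⟨ count-split here? early? J ⟩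
      count before? J + count rest? J                      ≡⟨ cong (count before? J +_) (count-split rest? late? J) ⟩
      count before? J + (count after? J + count across? J) ≤⟨ +-mono-≤ before≤2 (+-mono-≤ after≤2 across≤1) ⟩
      5                                                    ∎
      where
      open ≤-Reasoning
      before≤2 : count before? J ≤ 2
      before≤2 = at-most-two before? proj₁ early-chain
      after≤2 : count after? J ≤ 2
      after≤2 = at-most-two after? (proj₁ ∘ proj₁)
        λ { (x∈ , (hx , _) , lx) (y∈ , (hy , _) , ly) (z∈ , (hz , _) , lz) →
            late-chain (x∈ , hx , lx) (y∈ , hy , ly) (z∈ , hz , lz) }
      across≤1 : count across? J ≤ 1
      across≤1 = count-≤1 across? distinct clash
        where
        clash : ∀ {x y} → x ∈ J → y ∈ J →
          (Here x × ¬ Early x) × ¬ Late x → (Here y × ¬ Early y) × ¬ Late y → ¬ (x # y)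
        clash x∈ y∈ ((hx , ¬ex) , ¬lx) ((hy , ¬ey) , ¬ly) x#y with ordered x∈ y∈ hx hy x#y
        ... | inj₁ x≺y = ¬ex (≤-trans x≺y (≮⇒≥ ¬ly))
        ... | inj₂ y≺x = ¬ey (≤-trans y≺x (≮⇒≥ ¬lx))

  mid-count : ∀ J → (∀ {k} → k ∈ J → V k) → AllPairs _#_ J →
    (∀ {k} → k ∈ J → due k < 3 * len k + rel k) → ∀ t →
    count (λ k → runs? (mid (jb k)) (len k) t) J ≤ m * 5
  mid-count J valid distinct tight t =
    count-≤-fibres om (λ k → runs? (mid (jb k)) (len k) t) J 5 m (λ k∈ _ → om<m _ (valid k∈))
      (λ μ _ → Tight.machine-count J valid distinct tight t μ)

  -- By induction the older jobs occupy their centred intervals. Were `x` delayed, such an interval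
  -- on each of the `5 * m` machines would contain slot `mid (jb x)`; together with `x` these exceed
  -- the bound of `mid-count`.
  tight-on-time : ∀ {H} → Greedy mid (5 * m) H → AllPairs _#_ H → (∀ {k} → k ∈ H → V k) →
    (∀ {k} → k ∈ H → due k < 3 * len k + rel k) → ∀ {j} → j ∈ H → st j ≡ mid (jb j)
  tight-on-time (_ ∷ g) (_ ∷ ds) valid tight (there j∈) =
    tight-on-time g ds (valid ∘ there) (tight ∘ there) j∈
  tight-on-time {x ∷ h} (s ∷ g) (x#h ∷ ds) valid tight (here refl) = ≤-antisym (≮⇒≥ on-time) (e≤st s)
    where
    at-mid? = λ k → runs? (mid (jb k)) (len k) (mid (jb x))

    -- x itself sits on a fictitious extra machine.
    label : Placed → ℕ
    label k with idx k ≟ idx x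
    ... | yes _ = 5 * m
    ... | no  _ = mach k

    label-x : label x ≡ 5 * m
    label-x with idx x ≟ idx x
    ... | yes _ = refl
    ... | no ¬q = contradiction refl ¬q

    label-h : ∀ {k} → k ∈ h → label k ≡ mach k
    label-h {k} k∈ with idx k ≟ idx x
    ... | yes q = contradiction (sym q) (All.lookup x#h k∈)
    ... | no _  = refl

    -- `x` has to count in slot `mid (jb x)`. Its release date is at most its deadline, so tightness
    -- forces a positive length.
    0<len : 0 < len x
    0<len = positive (len x) (≤-<-trans (≤-trans (m≤m+n (rel x) (len x)) (≤-trans
      (+-monoˡ-≤ (len x) (rel≤os _ (valid (here refl)))) (os≤due _ (valid (here refl))))) (tight (here refl)))
      where
      positive : ∀ l {r} → r < 3 * l + r → 0 < l
      positive zero    r<r = contradiction r<r (n≮n _)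
      positive (suc _) _   = s≤s z≤n

    on-time : ¬ mid (jb x) < st x
    on-time mid<st = <⇒≱ (s≤s (≤-trans (mid-count (x ∷ h) valid (x#h ∷ ds) tight (mid (jb x))) (≤-reflexive (*-comm m 5))))
      (count-≥-fibres label at-mid? (x ∷ h) (suc (5 * m)) occupied)
      where
      occupied : ∀ μ → μ < suc (5 * m) → ∃ λ k → k ∈ x ∷ h × Runs (mid (jb k)) (len k) (mid (jb x)) × label k ≡ μ
      occupied μ μ≤ with m≤n⇒m<n∨m≡n (≤-pred μ≤)
      ... | inj₂ refl = x , here refl , (≤-refl , m<m+n (mid (jb x)) 0<len) , label-x
      ... | inj₁ μ< with blocked s mid<st μ μ<
      ...   | k , k∈ , refl , st≤end = k , there k∈ ,
        (e-mono s k∈ , <-≤-trans mid<st (≤-trans st≤end (≤-reflexive (cong (_+ len k)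
          (tight-on-time g ds (valid ∘ there) (tight ∘ there) k∈))))) , label-h k∈

-- Insertion sort across a threshold

module Split (O : DecTotalOrder 0ℓ 0ℓ 0ℓ) {Early : DecTotalOrder.Carrier O → Set} (early? : Decidable Early)
  (early-last : ∀ i j → Early i → ¬ Early j → ¬ DecTotalOrder._≤_ O i j) where

  open DecTotalOrder O using (Carrier; total) renaming (_≤_ to _≼_; _≤?_ to _≼?_)
  open InsertionSort O using (sort; insert)
  open InsertionSortProperties O using (sort-↭)

  late? : Decidable (λ i → ¬ Early i)
  late? i = ¬? (early? i)

  insert-early : ∀ {i} → Early i → ∀ {ls} es → All (λ l → ¬ Early l) ls →
    insert i (ls ++ es) ≡ ls ++ insert i es
  insert-early {i} ei {[]}     es []         = refl
  insert-early {i} ei {l ∷ ls} es (¬el ∷ ¬e) with i ≼? l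
  ... | yes i≼l = contradiction i≼l (early-last _ _ ei ¬el)
  ... | no _    = cong (l ∷_) (insert-early ei es ¬e)

  insert-late : ∀ {i} → ¬ Early i → ∀ ls {es} → All Early es →
    insert i (ls ++ es) ≡ insert i ls ++ es
  insert-late {i} ¬ei [] {[]}     []        = refl
  insert-late {i} ¬ei [] {e′ ∷ es} (ee ∷ _) with i ≼? e′
  ... | yes _   = refl
  ... | no ¬i≼e with total i e′
  ...   | inj₁ i≼e = contradiction i≼e ¬i≼e
  ...   | inj₂ e≼i = contradiction e≼i (early-last _ _ ee ¬ei)
  insert-late {i} ¬ei (l ∷ ls) ees with i ≼? l
  ... | yes _ = refl
  ... | no _  = cong (l ∷_) (insert-late ¬ei ls ees)

  all-sort : ∀ {Q : Carrier → Set} (Q? : Decidable Q) is → All Q (sort (filter Q? is))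
  all-sort Q? is = All.tabulate λ i∈ →
    proj₂ (∈-filter⁻ Q? {xs = is} (∈-resp-↭ (sort-↭ (filter Q? is)) i∈))

  -- An equality of lists is needed: `history` places the end of the list first, so early items are
  -- placed as if there were no late ones.
  sort-split : ∀ is → sort is ≡ sort (filter late? is) ++ sort (filter early? is)
  sort-split []       = refl
  sort-split (i ∷ is) with early? i
  ... | yes ei = trans (cong (insert i) (sort-split is))
                       (insert-early ei (sort (filter early? is)) (all-sort late? is))
  ... | no ¬ei = trans (cong (insert i) (sort-split is))
                       (insert-late ¬ei (sort (filter late? is)) (all-sort early? is))

-- List scheduling

Item : Set
Item = ℕ × Job

item : Placed → Item
item k = idx k , jb k

enumerate : ℕ → List Job → List Item
enumerate n []       = []
enumerate n (x ∷ xs) = (n , x) ∷ enumerate (suc n) xs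

enumerate-++ : ∀ n xs ys → enumerate n (xs ++ ys) ≡ enumerate n xs ++ enumerate (n + length xs) ys
enumerate-++ n []       ys = cong (λ k → enumerate k ys) (sym (+-identityʳ n))
enumerate-++ n (x ∷ xs) ys = cong ((n , x) ∷_)
  (trans (enumerate-++ (suc n) xs ys) (cong (λ k → enumerate (suc n) xs ++ enumerate k ys) (sym (+-suc n (length xs)))))

∈-enumerate⁺ : ∀ n xs i → (n + toℕ i , lookup xs i) ∈ enumerate n xs
∈-enumerate⁺ n (x ∷ xs) zero    = here (cong (_, x) (+-identityʳ n))
∈-enumerate⁺ n (x ∷ xs) (suc i) = there
  (subst (λ k → (k , lookup xs i) ∈ enumerate (suc n) xs) (sym (+-suc n (toℕ i))) (∈-enumerate⁺ (suc n) xs i))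

∈-enumerate⁻ : ∀ n xs {k x} → (k , x) ∈ enumerate n xs →
  Σ (Fin (length xs)) λ i → k ≡ n + toℕ i × x ≡ lookup xs i
∈-enumerate⁻ n (x ∷ xs) (here refl) = zero , sym (+-identityʳ n) , refl
∈-enumerate⁻ n (x ∷ xs) (there k∈) =
  let (i , k≡ , x≡) = ∈-enumerate⁻ (suc n) xs k∈ in suc i , trans k≡ (sym (+-suc n (toℕ i))) , x≡

enumerate-distinct : ∀ n xs → AllPairs (λ a b → proj₁ a ≢ proj₁ b) (enumerate n xs)
enumerate-distinct n []       = []
enumerate-distinct n (x ∷ xs) = All.tabulate later ∷ enumerate-distinct (suc n) xs
  where
  later : ∀ {b} → b ∈ enumerate (suc n) xs → n ≢ proj₁ b
  later b∈ refl = let (i , n≡ , _) = ∈-enumerate⁻ (suc n) xs b∈ in m≢1+m+n n n≡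

find : ℕ → List Placed → ℕ × ℕ
find n []      = 0 , 0
find n (k ∷ h) with idx k ≟ n
... | yes _ = mach k , st k
... | no  _ = find n h

find-∈ : ∀ {h} → AllPairs _#_ h → ∀ {k} → k ∈ h → find (idx k) h ≡ (mach k , st k)
find-∈ (_ ∷ _)    {k} (here refl) with idx k ≟ idx k
... | yes _ = refl
... | no ¬q = contradiction refl ¬q
find-∈ {x ∷ h} (x# ∷ ds) {k} (there k∈) with idx x ≟ idx k
... | yes q = contradiction q (All.lookup x# k∈)
... | no _  = find-∈ ds k∈

freeAt : List Placed → ℕ → ℕ
freeAt h μ = max 0 (map end (filter (λ k → mach k ≟ μ) h))

freeAt-≥ : ∀ {h k} → k ∈ h → end k ≤ freeAt h (mach k)
freeAt-≥ {h} {k} k∈ = All.lookup (xs≤max 0 (map end (filter (λ k′ → mach k′ ≟ mach k) h)))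
  (∈-map⁺ end (∈-filter⁺ (λ k′ → mach k′ ≟ mach k) k∈ refl))

freeAt-attained : ∀ h μ → 0 < freeAt h μ → ∃ λ k → k ∈ h × mach k ≡ μ × freeAt h μ ≡ end k
freeAt-attained h μ 0< with argmax-sel id 0 (map end (filter (λ k → mach k ≟ μ) h))
... | inj₁ ≡0 = contradiction 0< (<-irrefl (sym ≡0))
... | inj₂ e∈ with ∈-map⁻ end e∈
...   | k , k∈′ , eq = let (k∈ , μ≡) = ∈-filter⁻ (λ k → mach k ≟ μ) {xs = h} k∈′ in k , k∈ , μ≡ , eq

module ListScheduling (e : Job → ℕ) (K : ℕ) where

  earliest-free : List Placed → ℕ
  -- The default `0` is a legitimate machine as soon as `0 < K`.
  earliest-free h = argmin (freeAt h) 0 (upTo K)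

  place : Item → List Placed → Placed
  place (n , x) h = placed n x (earliest-free h) (e x ⊔ freeAt h (earliest-free h))

  history : List Item → List Placed
  history []       = []
  history (i ∷ is) = place i (history is) ∷ history is

  item-history : ∀ is → map item (history is) ≡ is
  item-history []       = refl
  item-history (i ∷ is) = cong (i ∷_) (item-history is)

  find-skip : ∀ n is js → All (λ i → proj₁ i ≢ n) is → find n (history (is ++ js)) ≡ find n (history js)
  find-skip n []             js []          = refl
  find-skip n ((k , _) ∷ is) js (k≢n ∷ ≢n) with k ≟ n
  ... | yes k≡n = contradiction k≡n k≢n
  ... | no _    = find-skip n is js ≢n

  history-mach< : 0 < K → ∀ is {k} → k ∈ history is → mach k < K
  history-mach< 0<K (i ∷ is) (here refl) =
    argmin-all (freeAt (history is)) {P = _< K} 0<K (All.tabulate ∈-upTo⁻)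
  history-mach< 0<K (i ∷ is) (there k∈) = history-mach< 0<K is k∈

  -- Reversed, because `history` places the last entry of its list first. Ties in `e` are broken by
  -- deadline for the sake of `loose-deadlines`.
  newestFirst : DecTotalOrder _ _ _
  newestFirst = Flip.decTotalOrder (On.decTotalOrder
    (×-decTotalOrder ≤-decTotalOrder ≤-decTotalOrder) (λ (i : Item) → e (proj₂ i) , d (proj₂ i)))

  open DecTotalOrder newestFirst public using ()
    renaming (_≤_ to _≼_; trans to ≼-trans)

  ≼⇒e≥ : ∀ {i j} → i ≼ j → e (proj₂ j) ≤ e (proj₂ i)
  ≼⇒e≥ (inj₁ (le , _)) = le
  ≼⇒e≥ (inj₂ (eq , _)) = ≤-reflexive eq

  ≼⇒tie : ∀ {i j} → i ≼ j → e (proj₂ j) ≡ e (proj₂ i) → d (proj₂ j) ≤ d (proj₂ i)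
  ≼⇒tie (inj₁ (_ , ≢)) eq = contradiction eq ≢
  ≼⇒tie (inj₂ (_ , le)) _ = le

  history-greedy : ∀ {is} → AllPairs _≼_ is → Greedy e K (history is)
  history-greedy {[]}     []        = []
  history-greedy {i ∷ is} (i≼ ∷ ps) = step ∷ history-greedy ps
    where
    h = history is
    μ₀ = earliest-free h
    older : ∀ {k} → k ∈ h → i ≼ item k
    older k∈ = All.lookup i≼ (subst (_ ∈_) (item-history is) (∈-map⁺ item k∈))
    step : GreedyStep e K (place i h) h
    step = record
      { e≤st    = m≤m⊔n (e (proj₂ i)) _
      ; free    = λ { k∈ refl → ≤-trans (freeAt-≥ k∈) (m≤n⊔m (e (proj₂ i)) _) }
      -- A delayed start is the moment at which the earliest free machine becomes free. No machine
      -- is free before it, and being positive this time is attained by the end of some job on each.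
      ; blocked = λ e<st μ μ<K →
          let e<free = ≰⇒> (λ free≤e → <⇒≱ e<st (⊔-lub ≤-refl free≤e))
              free≤  = All.lookup (f[argmin]≤f[xs] 0 (upTo K)) (∈-upTo⁺ μ<K)
              (k , k∈ , μ≡ , free≡) = freeAt-attained h μ (≤-<-trans z≤n (<-≤-trans e<free free≤))
          in k , k∈ , μ≡ , ≤-trans (⊔-lub (<⇒≤ e<free) ≤-refl) (≤-trans free≤ (≤-reflexive free≡))
      ; e-mono  = λ {k} k∈ → ≼⇒e≥ {i} {item k} (older k∈)
      ; tie     = λ {k} k∈ → ≼⇒tie {i} {item k} (older k∈)
      }

  open InsertionSort newestFirst public using (sort)
  open InsertionSortProperties newestFirst public using (sort-↭; sort-↗)

  sorted : ∀ is → AllPairs _≼_ (sort is)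
  sorted is = Linked⇒AllPairs (λ {i} {j} {k} → ≼-trans {i} {j} {k}) (sort-↗ is)

-- Dependence of a plan on the known jobs

dropWhile-prefix : ∀ {P : A → Set} (P? : Decidable P) xs →
  (∀ i j → toℕ i ≤ toℕ j → P (lookup xs j) → P (lookup xs i)) → All (λ x → ¬ P x) (dropWhile P? xs)
dropWhile-prefix P? []       _ = []
dropWhile-prefix {P = P} P? (x ∷ xs) prefix with P? x
... | yes _  = dropWhile-prefix P? xs (λ i j i≤j → prefix (suc i) (suc j) (s≤s i≤j))
... | no ¬px = ¬px ∷ All.tabulate λ y∈ py →
  ¬px (prefix zero (suc (index y∈)) z≤n (subst P (lookup-index y∈) py))

Known-complement : ∀ t I → ReleaseSorted I → All (λ x → ¬ r x ≤ t) (dropWhile (λ j → r j ≤? t) I)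
Known-complement t I rs = dropWhile-prefix (λ j → r j ≤? t) I (λ i j i≤j → ≤-trans (rs i j i≤j))

module Plan (e : Job → ℕ) (rel≤e : ∀ x → r x ≤ e x) {C : Job → Set} (C? : Decidable C) (K : ℕ) where

  open ListScheduling e K

  inC? : Decidable (λ (i : Item) → C (proj₂ i))
  inC? i = C? (proj₂ i)

  plan : Instance → List Placed
  plan I = history (sort (filter inC? (enumerate 0 I)))

  plan-greedy : ∀ I → Greedy e K (plan I)
  plan-greedy I = history-greedy (sorted (filter inC? (enumerate 0 I)))

  plan-mach< : ∀ I → 0 < K → ∀ {k} → k ∈ plan I → mach k < K
  plan-mach< I 0<K = history-mach< 0<K (sort (filter inC? (enumerate 0 I)))

  plan-distinct : ∀ I → AllPairs _#_ (plan I)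
  plan-distinct I = AllPairs.map⁻ (subst (AllPairs _) (sym (item-history _))
    (AllPairs-resp-↭ (setoid Item) (λ i≢j → i≢j ∘ sym) ((λ { refl → id }) , (λ { refl → id }))
      (↭⇒↭ₛ (↭-sym (sort-↭ (filter inC? (enumerate 0 I)))))
      (AllPairs.filter⁺ inC? (enumerate-distinct 0 I))))

  plan-sound : ∀ I {k} → k ∈ plan I →
    (Σ (Fin (length I)) λ i → idx k ≡ toℕ i × jb k ≡ lookup I i) × C (jb k)
  plan-sound I {k} k∈ =
    let i∈ = ∈-resp-↭ (sort-↭ (filter inC? (enumerate 0 I)))
               (subst (item k ∈_) (item-history _) (∈-map⁺ item k∈))
        (i∈′ , c) = ∈-filter⁻ inC? {xs = enumerate 0 I} i∈
    in ∈-enumerate⁻ 0 I i∈′ , c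

  plan-complete : ∀ I i → C (lookup I i) → ∃ λ k → k ∈ plan I × idx k ≡ toℕ i × jb k ≡ lookup I i
    × find (toℕ i) (plan I) ≡ (mach k , st k)
  plan-complete I i c
    with ∈-map⁻ item (subst (_ ∈_) (sym (item-history _))
           (∈-resp-↭ (↭-sym (sort-↭ (filter inC? (enumerate 0 I)))) (∈-filter⁺ inC? (∈-enumerate⁺ 0 I i) c)))
  ... | k , k∈ , refl = k , k∈ , refl , refl , find-∈ (plan-distinct I) k∈

  module _ (t : ℕ) where

    early? : Decidable (λ (i : Item) → e (proj₂ i) ≤ t)
    early? i = e (proj₂ i) ≤? t

    early-last : ∀ i j → e (proj₂ i) ≤ t → ¬ e (proj₂ j) ≤ t → ¬ (i ≼ j)
    early-last i j ei ¬ej i≼j = ¬ej (≤-trans (≼⇒e≥ {i} {j} i≼j) ei)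

    open Split newestFirst early? early-last

    settled : Instance → List Placed
    settled I = history (sort (filter early? (filter inC? (enumerate 0 I))))

    -- A job outside `Known t I` is released after `t`, so its `e` exceeds `t` too. The known jobs
    -- form a prefix and keep their indices.
    settled-Known : ∀ I → ReleaseSorted I → settled I ≡ settled (Known t I)
    settled-Known I rs = cong (history ∘ sort) (begin
      F (enumerate 0 I)                       ≡⟨ cong (F ∘ enumerate 0) (takeWhile++dropWhile (λ j → r j ≤? t) I) ⟨
      F (enumerate 0 (Known t I ++ rest))     ≡⟨ cong F (enumerate-++ 0 (Known t I) rest) ⟩
      F (enumerate 0 (Known t I) ++ enumerate (length (Known t I)) rest)
        ≡⟨ cong (filter early?) (filter-++ inC? (enumerate 0 (Known t I)) _) ⟩
      filter early? (filter inC? (enumerate 0 (Known t I)) ++ filter inC? (enumerate (length (Known t I)) rest))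
        ≡⟨ filter-++ early? (filter inC? (enumerate 0 (Known t I))) _ ⟩
      F (enumerate 0 (Known t I)) ++ F (enumerate (length (Known t I)) rest)
        ≡⟨ cong (F (enumerate 0 (Known t I)) ++_) (filter-none early? (All.tabulate unreleased)) ⟩
      F (enumerate 0 (Known t I)) ++ []       ≡⟨ ++-identityʳ _ ⟩
      F (enumerate 0 (Known t I))             ∎)
      where
      open ≡-Reasoning
      rest = dropWhile (λ j → r j ≤? t) I
      F : List Item → List Item
      F = filter early? ∘ filter inC?
      unreleased : ∀ {i} → i ∈ filter inC? (enumerate (length (Known t I)) rest) → ¬ e (proj₂ i) ≤ t
      unreleased i∈ e≤t
        with ∈-enumerate⁻ (length (Known t I)) rest (proj₁ (∈-filter⁻ inC? i∈))
      ... | i , _ , refl = All.lookup (Known-complement t I rs) (∈-lookup i) (≤-trans (rel≤e _) e≤t)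

    -- Jobs with `e` beyond `t` are placed after all others, and `find` skips them as their indices
    -- differ.
    find-settled : ∀ I i → e (lookup I i) ≤ t → find (toℕ i) (plan I) ≡ find (toℕ i) (settled I)
    find-settled I i e≤t = trans
      (cong (find (toℕ i) ∘ history) (sort-split items))
      (find-skip (toℕ i) (sort (filter late? items)) (sort (filter early? items)) (All.tabulate other))
      where
      items = filter inC? (enumerate 0 I)
      other : ∀ {k} → k ∈ sort (filter late? items) → proj₁ k ≢ toℕ i
      other k∈ refl
        with ∈-filter⁻ late? {xs = items} (∈-resp-↭ (sort-↭ (filter late? items)) k∈)
      ... | k∈′ , late with ∈-enumerate⁻ 0 I (proj₁ (∈-filter⁻ inC? {xs = enumerate 0 I} k∈′))
      ...   | i′ , i≡ , refl with toℕ-injective i≡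
      ...     | refl = late e≤t

    plan-online : ∀ I I′ → ReleaseSorted I → ReleaseSorted I′ → Known t I ≡ Known t I′ →
      ∀ i i′ → toℕ i ≡ toℕ i′ → lookup I i ≡ lookup I′ i′ → e (lookup I i) ≤ t →
      find (toℕ i) (plan I) ≡ find (toℕ i′) (plan I′)
    plan-online I I′ rs rs′ known i i′ i≡ x≡ e≤t = begin
      find (toℕ i) (plan I)               ≡⟨ find-settled I i e≤t ⟩
      find (toℕ i) (settled I)            ≡⟨ cong (find (toℕ i)) (settled-Known I rs) ⟩
      find (toℕ i) (settled (Known t I))  ≡⟨ cong₂ (λ n J → find n (settled J)) i≡ known ⟩
      find (toℕ i′) (settled (Known t I′)) ≡⟨ cong (find (toℕ i′)) (settled-Known I′ rs′) ⟨
      find (toℕ i′) (settled I′)          ≡⟨ find-settled I′ i′ (subst (λ x → e x ≤ t) x≡ e≤t) ⟨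
      find (toℕ i′) (plan I′)             ∎
      where open ≡-Reasoning

-- The algorithm

Loose : Job → Set
Loose x = 3 * p x + r x ≤ d x

loose? : Decidable Loose
loose? x = 3 * p x + r x ≤? d x

module LoosePlan (m : ℕ) = Plan r (λ _ → ≤-refl) loose? (4 * m)
module TightPlan (m : ℕ) = Plan mid (λ x → m≤m+n (r x) _) (λ x → ¬? (loose? x)) (5 * m)

loosely tightly : ∀ m I → Fin (length I) → ℕ × ℕ
loosely m I i = find (toℕ i) (LoosePlan.plan m I)
-- The shift keeps the two plans on disjoint sets of machines.
tightly m I i = let (μ , s) = find (toℕ i) (TightPlan.plan m I) in 4 * m + μ , s

decide : {X : Set} → Dec X → A → A → A
decide (yes _) a b = a
decide (no _)  a b = b

decide-yes : {X : Set} (c : Dec X) {a b : A} → X → decide c a b ≡ a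
decide-yes (yes _) _ = refl
decide-yes (no ¬x) x = contradiction x ¬x

decide-no : {X : Set} (c : Dec X) {a b : A} → ¬ X → decide c a b ≡ b
decide-no (yes x) ¬x = contradiction x ¬x
decide-no (no _)  _  = refl

algorithm : Algorithm
algorithm m I i = decide (loose? (lookup I i)) (loosely m I i) (tightly m I i)

data Placement (m : ℕ) (I : Instance) (i : Fin (length I)) : Set where
  loose : ∀ k → k ∈ LoosePlan.plan m I → idx k ≡ toℕ i → jb k ≡ lookup I i →
    algorithm m I i ≡ (mach k , st k) → Placement m I i
  tight : ∀ k → k ∈ TightPlan.plan m I → idx k ≡ toℕ i → jb k ≡ lookup I i →
    algorithm m I i ≡ (4 * m + mach k , st k) → Placement m I i

placement : ∀ m I i → Placement m I i
placement m I i with loose? (lookup I i)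
... | yes l = let (k , k∈ , n≡ , x≡ , found) = LoosePlan.plan-complete m I i l
  in loose k k∈ n≡ x≡ (trans (decide-yes (loose? (lookup I i)) l) found)
... | no ¬l = let (k , k∈ , n≡ , x≡ , found) = TightPlan.plan-complete m I i ¬l
  in tight k k∈ n≡ x≡ (trans (decide-no (loose? (lookup I i)) ¬l) (cong (λ (μ , s) → 4 * m + μ , s) found))

-- Decisions from known jobs only

enumerate-Known : ∀ t I → enumerate 0 I ≡
  enumerate 0 (Known t I) ++ enumerate (length (Known t I)) (dropWhile (λ j → r j ≤? t) I)
enumerate-Known t I = trans
  (cong (enumerate 0) (sym (takeWhile++dropWhile (λ j → r j ≤? t) I)))
  (enumerate-++ 0 (Known t I) _)

-- What follows the prefix `Known t I` is released after `t`, so `i` lies in the prefix, which `I′`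
-- shares with the same indices.
Known-lookup : ∀ t I I′ → Known t I ≡ Known t I′ → ReleaseSorted I →
  ∀ i i′ → toℕ i ≡ toℕ i′ → r (lookup I i) ≤ t → lookup I i ≡ lookup I′ i′
Known-lookup t I I′ known rs i i′ i≡ r≤t
  with ∈-++⁻ (enumerate 0 (Known t I)) (subst (_ ∈_) (enumerate-Known t I) (∈-enumerate⁺ 0 I i))
... | inj₂ i∈ with ∈-enumerate⁻ _ (dropWhile (λ j → r j ≤? t) I) i∈
...   | i″ , _ , x≡ = contradiction (subst (λ x → r x ≤ t) x≡ r≤t)
  (All.lookup (Known-complement t I rs) (∈-lookup i″))
Known-lookup t I I′ known rs i i′ i≡ r≤t | inj₁ i∈
  with ∈-enumerate⁻ 0 I′ (subst (_ ∈_) (sym (enumerate-Known t I′))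
         (∈-++⁺ˡ (subst (λ J → _ ∈ enumerate 0 J) known i∈)))
... | i″ , i≡″ , x≡ = trans x≡ (cong (lookup I′) (toℕ-injective (trans (sym i≡″) i≡)))

semi-online : SemiOnline algorithm
semi-online m I I′ t rs rs′ known i i′ i≡ r≤t s≤t
  with Known-lookup t I I′ known rs i i′ i≡ r≤t | placement m I i
... | x≡ | loose k k∈ n≡ jb≡ alg≡ = sym (begin
  algorithm m I i      ≡⟨ decide-yes (loose? (lookup I i)) is-loose ⟩
  loosely m I i        ≡⟨ LoosePlan.plan-online m t I I′ rs rs′ known i i′ i≡ x≡ r≤t ⟩
  loosely m I′ i′      ≡⟨ decide-yes (loose? (lookup I′ i′)) (subst Loose x≡ is-loose) ⟨
  algorithm m I′ i′    ∎)
  where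
  open ≡-Reasoning
  is-loose : Loose (lookup I i)
  is-loose = subst Loose jb≡ (proj₂ (LoosePlan.plan-sound m I k∈))
... | x≡ | tight k k∈ n≡ jb≡ alg≡ = sym (begin
  algorithm m I i      ≡⟨ decide-no (loose? (lookup I i)) ¬loose ⟩
  tightly m I i        ≡⟨ cong (λ (μ , s) → 4 * m + μ , s)
                            (TightPlan.plan-online m t I I′ rs rs′ known i i′ i≡ x≡ mid≤t) ⟩
  tightly m I′ i′      ≡⟨ decide-no (loose? (lookup I′ i′)) (subst (λ x → ¬ Loose x) x≡ ¬loose) ⟨
  algorithm m I′ i′    ∎)
  where
  open ≡-Reasoning
  ¬loose : ¬ Loose (lookup I i)
  ¬loose = subst (λ x → ¬ Loose x) jb≡ (proj₂ (TightPlan.plan-sound m I k∈))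
  -- No tight job starts before `mid`, so one that has started by `t` belongs to the settled part of
  -- the plan.
  mid≤t : mid (lookup I i) ≤ t
  mid≤t = ≤-trans (subst (λ x → mid x ≤ st k) jb≡ (greedy-e≤st (TightPlan.plan-greedy m I) k∈))
                  (≤-trans (≤-reflexive (sym (cong proj₂ alg≡))) s≤t)

-- `Placed` stores indices in ℕ while a schedule is defined on `Fin`; at a valid index the default
-- `b` is not reached.
at : ∀ {n} {B : Set} → B → (Fin n → B) → ℕ → B
at {zero}  b f _       = b
at {suc n} b f zero    = f zero
at {suc n} b f (suc k) = at b (f ∘ suc) k

at-toℕ : ∀ {n} {B : Set} (b : B) (f : Fin n → B) i → at b f (toℕ i) ≡ f i
at-toℕ b f zero    = refl
at-toℕ b f (suc i) = at-toℕ b (f ∘ suc) i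

-- Feasibility on 9m machines

module Optimal (m : ℕ) (I : Instance) (agreeable : Agreeable I) (σ : Schedule I) (feasible : FeasibleSchedule I m σ) where

  opt : Placed → ℕ × ℕ
  opt k = at (0 , 0) σ (idx k)

  Valid : Placed → Set
  Valid k = Σ (Fin (length I)) λ i → idx k ≡ toℕ i × jb k ≡ lookup I i

  opt-σ : ∀ {k} (i : Fin (length I)) → idx k ≡ toℕ i → opt k ≡ σ i
  opt-σ i refl = at-toℕ (0 , 0) σ i

  optMach optStart : Placed → ℕ
  optMach  = proj₁ ∘ opt
  optStart = proj₂ ∘ opt

  optMach<m : ∀ k → Valid k → optMach k < m
  optMach<m k (i , n≡ , _) rewrite opt-σ {k} i n≡ = proj₁ feasible i

  rel≤optStart : ∀ k → Valid k → rel k ≤ optStart k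
  rel≤optStart k (i , n≡ , x≡) rewrite opt-σ {k} i n≡ | x≡ = proj₁ (proj₂ feasible) i

  optEnd≤due : ∀ k → Valid k → optStart k + len k ≤ due k
  optEnd≤due k (i , n≡ , x≡) rewrite opt-σ {k} i n≡ | x≡ = proj₁ (proj₂ (proj₂ feasible)) i

  opt-disjoint : ∀ k k′ → Valid k → Valid k′ → k # k′ → optMach k ≡ optMach k′ →
    optStart k + len k ≤ optStart k′ ⊎ optStart k′ + len k′ ≤ optStart k
  opt-disjoint k k′ (i , n≡ , x≡) (i′ , n≡′ , x≡′) k#k′ μ≡
    rewrite opt-σ {k} i n≡ | opt-σ {k′} i′ n≡′ | x≡ | x≡′ =
    proj₂ (proj₂ (proj₂ feasible)) i i′ (λ { refl → k#k′ (trans n≡ (sym n≡′)) }) μ≡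

  agree : ∀ k k′ → Valid k → Valid k′ → rel k < rel k′ → due k ≤ due k′
  agree k k′ (i , _ , x≡) (i′ , _ , x≡′) rewrite x≡ | x≡′ = agreeable i i′

  open Against m Valid optMach optStart optMach<m rel≤optStart optEnd≤due opt-disjoint agree

  valid-loose : ∀ {k} → k ∈ LoosePlan.plan m I → Valid k
  valid-loose = proj₁ ∘ LoosePlan.plan-sound m I

  valid-tight : ∀ {k} → k ∈ TightPlan.plan m I → Valid k
  valid-tight = proj₁ ∘ TightPlan.plan-sound m I

  loose-end : ∀ {k} → k ∈ LoosePlan.plan m I → end k ≤ due k
  loose-end = loose-deadlines (LoosePlan.plan-greedy m I) (LoosePlan.plan-distinct m I)
    valid-loose (proj₂ ∘ LoosePlan.plan-sound m I)

  tight-end : ∀ {k} → k ∈ TightPlan.plan m I → end k ≤ due k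
  tight-end {k} k∈ = subst (λ s → s + len k ≤ due k)
    (sym (tight-on-time (TightPlan.plan-greedy m I) (TightPlan.plan-distinct m I)
      valid-tight (≰⇒> ∘ proj₂ ∘ TightPlan.plan-sound m I) k∈))
    (mid-fits {k} (valid-tight k∈))

  positive : ∀ c {{_ : NonZero c}} → Fin (length I) → 0 < c * m
  positive c i = *-mono-≤ (>-nonZero⁻¹ c) (≤-<-trans z≤n (proj₁ feasible i))

  machines : ∀ i → machine I (algorithm m I) i < 9 * m
  machines i with placement m I i
  ... | loose k k∈ _ _ alg≡ rewrite alg≡ = <-≤-trans
    (LoosePlan.plan-mach< m I (positive 4 i) k∈) (*-monoˡ-≤ m (m≤m+n 4 5))
  ... | tight k k∈ _ _ alg≡ rewrite alg≡ = <-≤-trans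
    (+-monoʳ-< (4 * m) (TightPlan.plan-mach< m I (positive 5 i) k∈))
    (≤-reflexive (sym (*-distribʳ-+ m 4 5)))

  releases : ∀ i → r (JobOf I i) ≤ start I (algorithm m I) i
  releases i with placement m I i
  ... | loose k k∈ _ x≡ alg≡ rewrite alg≡ | sym x≡ = greedy-e≤st (LoosePlan.plan-greedy m I) k∈
  ... | tight k k∈ _ x≡ alg≡ rewrite alg≡ | sym x≡ =
    ≤-trans (m≤m+n (rel k) _) (greedy-e≤st (TightPlan.plan-greedy m I) k∈)

  deadlines : ∀ i → start I (algorithm m I) i + p (JobOf I i) ≤ d (JobOf I i)
  deadlines i with placement m I i
  ... | loose k k∈ _ x≡ alg≡ rewrite alg≡ | sym x≡ = loose-end k∈
  ... | tight k k∈ _ x≡ alg≡ rewrite alg≡ | sym x≡ = tight-end k∈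

  exclusive : ∀ i j → i ≢ j → machine I (algorithm m I) i ≡ machine I (algorithm m I) j →
    start I (algorithm m I) i + p (JobOf I i) ≤ start I (algorithm m I) j ⊎
    start I (algorithm m I) j + p (JobOf I j) ≤ start I (algorithm m I) i
  exclusive i j i≢j μ≡ with placement m I i | placement m I j
  ... | loose k k∈ n≡ x≡ alg≡ | loose k′ k′∈ n≡′ x≡′ alg≡′ rewrite alg≡ | alg≡′ | sym x≡ | sym x≡′ =
    greedy-disjoint (LoosePlan.plan-greedy m I) k∈ k′∈
      (λ eq → i≢j (toℕ-injective (trans (sym n≡) (trans eq n≡′)))) μ≡
  ... | tight k k∈ n≡ x≡ alg≡ | tight k′ k′∈ n≡′ x≡′ alg≡′ rewrite alg≡ | alg≡′ | sym x≡ | sym x≡′ =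
    greedy-disjoint (TightPlan.plan-greedy m I) k∈ k′∈
      (λ eq → i≢j (toℕ-injective (trans (sym n≡) (trans eq n≡′)))) (+-cancelˡ-≡ (4 * m) _ _ μ≡)
  ... | loose k k∈ _ _ alg≡ | tight k′ _ _ _ alg≡′ rewrite alg≡ | alg≡′ =
    contradiction μ≡ (<⇒≢ (<-≤-trans (LoosePlan.plan-mach< m I (positive 4 i) k∈) (m≤m+n (4 * m) _)))
  ... | tight k _ _ _ alg≡ | loose k′ k′∈ _ _ alg≡′ rewrite alg≡ | alg≡′ =
    contradiction (sym μ≡) (<⇒≢ (<-≤-trans (LoosePlan.plan-mach< m I (positive 4 j) k′∈) (m≤m+n (4 * m) _)))

competitive : Competitive 9 algorithm
competitive I m _ _ agreeable ((σ , feasible) , _) = machines , releases , deadlines , exclusive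
  where open Optimal m I agreeable σ feasible

theorem6 : Σ Algorithm (λ A → SemiOnline A × Competitive 9 A)
theorem6 = algorithm , semi-online , competitive
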